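{- Let $K$ be a number field with algebraic closure $\overline{K}$, let $b\in K$, $b\neq 0$, and let $\mathcal{E}$ be the elliptic curve over $K$ with Weierstrass equation $y^2=x^3+bx$. Let $i\in\overline{K}$ be a root of $x^2+1=0$, let $\zeta_5\in\overline{K}$ be a primitive $5$-th root of unity, and put $$\theta_1:=-\left((-4i+4)\zeta_5^3+4\zeta_5^2-4i\zeta_5-2i+5\right).$$ Then $$K_5=K\left(\zeta_5,\, i,\, \sqrt{(\theta_1+1)\,b\,\sqrt{\theta_1 b}}\right).$$
   Context: $\mathcal{E}[5]$ denotes the $5$-torsion subgroup of $\mathcal{E}(\overline{K})$, and $K_5:=K(\mathcal{E}[5])$ is the field obtained by adjoining to $K$ the coordinates of all the points of $\mathcal{E}[5]$. The symbols $\sqrt{\theta_1 b}$ and $\sqrt{(\theta_1+1)b\sqrt{\theta_1 b}}$ denote fixed square roots in $\overline{K}$, the same $\sqrt{\theta_1 b}$ being used inside the second one. -}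

module Defs where

open import Algebra.Apartness.Bundles using (HeytingCommutativeRing; HeytingField)
open import Algebra.Bundles using (CommutativeRing)
open import Algebra.Bundles.Raw using (RawMonoid)
import Algebra.Definitions.RawMonoid as RawMonoidDefinitions
open import Algebra.Morphism.Structures using (module RingMorphisms)
import Algebra.Properties.AbelianGroup as AbelianGroupProperties
import Algebra.Properties.Ring as RingProperties
import Algebra.Properties.Semiring.Exp as SemiringExp
import Algebra.Properties.Semiring.Mult as SemiringMult
import Algebra.Properties.Semiring.Sum as SemiringSum
import Algebra.Solver.Ring as RingSolver
import Algebra.Solver.Ring.AlmostCommutativeRing as ACR
open import Data.Fin.Base using (toℕ; fromℕ)
open import Data.Integer.Base as ℤ using (ℤ; +_; -[1+_])
import Data.Integer.Properties as ℤ
open import Data.Maybe.Base using (Maybe; just; nothing)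
open import Data.Nat.Base as ℕ using (ℕ; zero; suc)
import Data.Nat.Properties as ℕ
open import Data.Product.Base using (Σ; ∃-syntax; _×_; _,_; proj₁; proj₂)
import Data.Rational.Properties as ℚ
open import Data.Sum.Base using (_⊎_)
open import Data.Unit.Base using (⊤)
open import Data.Empty using (⊥)
open import Data.Vec.Functional using (Vector)
open import Level using (Level; _⊔_; 0ℓ; Lift)
open import Relation.Binary.Definitions using (Decidable)
import Relation.Binary.PropositionalEquality.Core as ≡
import Relation.Binary.Reasoning.Setoid as SetoidReasoning
open import Relation.Nullary.Decidable.Core using (yes; no; ¬?)
open import Relation.Unary using (Pred)

private
  variable
    c ℓ ℓ′ c₁ ℓ₁ ℓ₁′ c₂ ℓ₂ ℓ₂′ p : Level

-- A Heyting field with decidable apartness is a field in the classical sense: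
-- by tightness, any two elements are equal or have an invertible difference.
record Field c ℓ ℓ′ : Set (Level.suc (c ⊔ ℓ ⊔ ℓ′)) where
  field
    heytingField : HeytingField c ℓ ℓ′

  open HeytingField heytingField public

  field
    _#?_ : Decidable _#_

  commutativeRing : CommutativeRing c ℓ
  commutativeRing = HeytingCommutativeRing.commutativeRing heytingCommutativeRing

  open CommutativeRing commutativeRing public
    using (_≉_; ring; rawRing; semiring; +-abelianGroup)
  open SemiringExp semiring public using (_^_; ^-congˡ)
  open SemiringMult semiring public renaming (_×_ to _·_) using ()
  open SemiringSum semiring public using (sum)

  -- inverse of x - y
  ⟨_⟩⁻¹ : ∀ {x y} → x # y → Carrier
  ⟨ x#y ⟩⁻¹ = proj₁ (#⇒invertible x#y)

  IsPrimitiveRoot : ℕ → Carrier → Set ℓ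
  IsPrimitiveRoot n z =
    z ^ n ≈ 1# × (∀ m → 0 ℕ.< m → m ℕ.< n → z ^ m ≉ 1#)

  -- value at x of the polynomial ∑ⱼ aⱼ Xʲ
  eval : ∀ {n} → Vector Carrier n → Carrier → Carrier
  eval a x = sum (λ j → a j * x ^ toℕ j)

module IntegerCoefficientSolver (F : Field c ℓ ℓ′) where
  open Field F
  open SemiringMult semiring using (×-homo-+; ×1-homo-*)
  open RingProperties ring using (-‿distribˡ-*; -‿distribʳ-*; -0#≈0#; -‿involutive)
  open AbelianGroupProperties +-abelianGroup using (⁻¹-∙-comm)
  open SetoidReasoning setoid

  almostCommutativeRing : ACR.AlmostCommutativeRing c ℓ
  almostCommutativeRing = ACR.fromCommutativeRing commutativeRing

  fromℤ : ℤ → Carrier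
  fromℤ (+ n)    = n · 1#
  fromℤ -[1+ n ] = - (suc n · 1#)

  fromℤ-⊖ : ∀ m n → fromℤ (m ℤ.⊖ n) ≈ m · 1# - n · 1#
  fromℤ-⊖ m zero = begin
    m · 1#          ≈⟨ +-identityʳ _ ⟨
    m · 1# + 0#     ≈⟨ +-congˡ -0#≈0# ⟨
    m · 1# - 0#     ∎
  fromℤ-⊖ zero (suc n) = sym (+-identityˡ _)
  fromℤ-⊖ (suc m) (suc n) = begin
    fromℤ (suc m ℤ.⊖ suc n)           ≡⟨ ≡.cong fromℤ (ℤ.[1+m]⊖[1+n]≡m⊖n m n) ⟩
    fromℤ (m ℤ.⊖ n)                       ≈⟨ fromℤ-⊖ m n ⟩
    a - b                                 ≈⟨ +-congʳ (+-identityˡ a) ⟨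
    0# + a - b                            ≈⟨ +-congʳ (+-congʳ (-‿inverseʳ 1#)) ⟨
    1# - 1# + a - b                       ≈⟨ +-congʳ (+-assoc 1# (- 1#) a) ⟩
    1# + (- 1# + a) - b                   ≈⟨ +-congʳ (+-congˡ (+-comm (- 1#) a)) ⟩
    1# + (a - 1#) - b                     ≈⟨ +-congʳ (+-assoc 1# a (- 1#)) ⟨
    1# + a - 1# - b                       ≈⟨ +-assoc (1# + a) (- 1#) (- b) ⟩
    1# + a + (- 1# - b)                   ≈⟨ +-congˡ (⁻¹-∙-comm 1# b) ⟩
    1# + a - (1# + b)                     ∎
    where
    a = m · 1#
    b = n · 1#

  fromℤ-+ : ∀ x y → fromℤ (x ℤ.+ y) ≈ fromℤ x + fromℤ y
  fromℤ-+ (+ m) (+ n) = ×-homo-+ 1# m n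
  fromℤ-+ (+ m) -[1+ n ] = fromℤ-⊖ m (suc n)
  fromℤ-+ -[1+ m ] (+ n) = trans (fromℤ-⊖ n (suc m)) (+-comm _ _)
  fromℤ-+ -[1+ m ] -[1+ n ] = begin
    - (suc (suc (m ℕ.+ n)) · 1#)       ≡⟨ ≡.cong (λ k → - (suc k · 1#)) (ℕ.+-suc m n) ⟨
    - ((suc m ℕ.+ suc n) · 1#)         ≈⟨ -‿cong (×-homo-+ 1# (suc m) (suc n)) ⟩
    - (suc m · 1# + suc n · 1#)        ≈⟨ ⁻¹-∙-comm _ _ ⟨
    - (suc m · 1#) - suc n · 1#        ∎

  fromℤ-neg : ∀ x → fromℤ (ℤ.- x) ≈ - fromℤ x
  fromℤ-neg (+ zero)  = sym -0#≈0#
  fromℤ-neg (+ suc n) = refl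
  fromℤ-neg -[1+ n ]  = sym (-‿involutive _)

  fromℤ-+* : ∀ m y → fromℤ (+ m ℤ.* y) ≈ m · 1# * fromℤ y
  fromℤ-+* m (+ n) = begin
    fromℤ (+ m ℤ.* + n)    ≡⟨ ≡.cong fromℤ (ℤ.pos-* m n) ⟨
    (m ℕ.* n) · 1#         ≈⟨ ×1-homo-* m n ⟩
    m · 1# * n · 1#        ∎
  fromℤ-+* m -[1+ n ] = begin
    fromℤ (+ m ℤ.* -[1+ n ])          ≡⟨ ≡.cong fromℤ (ℤ.neg-distribʳ-* (+ m) (+ suc n)) ⟨
    fromℤ (ℤ.- (+ m ℤ.* + suc n))   ≈⟨ fromℤ-neg (+ m ℤ.* + suc n) ⟩
    - fromℤ (+ m ℤ.* + suc n)       ≈⟨ -‿cong (fromℤ-+* m (+ suc n)) ⟩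
    - (m · 1# * suc n · 1#)         ≈⟨ -‿distribʳ-* _ _ ⟩
    m · 1# * fromℤ -[1+ n ]           ∎

  fromℤ-* : ∀ x y → fromℤ (x ℤ.* y) ≈ fromℤ x * fromℤ y
  fromℤ-* (+ m) y = fromℤ-+* m y
  fromℤ-* -[1+ m ] y = begin
    fromℤ (-[1+ m ] ℤ.* y)          ≡⟨ ≡.cong fromℤ (ℤ.neg-distribˡ-* (+ suc m) y) ⟨
    fromℤ (ℤ.- (+ suc m ℤ.* y))   ≈⟨ fromℤ-neg (+ suc m ℤ.* y) ⟩
    - fromℤ (+ suc m ℤ.* y)       ≈⟨ -‿cong (fromℤ-+* (suc m) y) ⟩
    - (suc m · 1# * fromℤ y)      ≈⟨ -‿distribˡ-* _ _ ⟩
    fromℤ -[1+ m ] * fromℤ y        ∎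

  morphism : ℤ.+-*-rawRing ACR.-Raw-AlmostCommutative⟶ almostCommutativeRing
  morphism = record
    { ⟦_⟧    = fromℤ
    ; +-homo = fromℤ-+
    ; *-homo = fromℤ-*
    ; -‿homo = fromℤ-neg
    ; 0-homo = refl
    ; 1-homo = +-identityʳ 1#
    }

  _coeff≟_ : (x y : ℤ) → Maybe (fromℤ x ≈ fromℤ y)
  x coeff≟ y with x ℤ.≟ y
  ... | yes ≡.refl = just refl
  ... | no _       = nothing

  open RingSolver ℤ.+-*-rawRing almostCommutativeRing morphism _coeff≟_ public
    using (solve; _:=_; _:+_; _:*_; _:-_; :-_; _:^_; _:×_; con)

ℚ-field : Field 0ℓ 0ℓ 0ℓ
ℚ-field = record
  { heytingField = ℚ.heytingField
  ; _#?_         = λ x y → ¬? (x ℚ.≟ y)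
  }

record Extension (F : Field c₁ ℓ₁ ℓ₁′) (L : Field c₂ ℓ₂ ℓ₂′)
                 : Set (c₁ ⊔ ℓ₁ ⊔ c₂ ⊔ ℓ₂) where
  private
    module F = Field F
    module L = Field L

  field
    embed     : F.Carrier → L.Carrier
    embed-hom : RingMorphisms.IsRingHomomorphism F.rawRing L.rawRing embed

module _ {F : Field c₁ ℓ₁ ℓ₁′} {L : Field c₂ ℓ₂ ℓ₂′} (E : Extension F L) where
  private
    module F = Field F
  open Field L
  open Extension E

  IsFinite : Set (c₁ ⊔ c₂ ⊔ ℓ₂)
  IsFinite = ∃[ n ] Σ (Vector Carrier n) λ e →
    ∀ x → Σ (Vector F.Carrier n) λ a → x ≈ sum (λ j → embed (a j) * e j)

  IsAlgebraic : Set (c₁ ⊔ ℓ₁′ ⊔ c₂ ⊔ ℓ₂)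
  IsAlgebraic = ∀ x → ∃[ n ] Σ (Vector F.Carrier n) λ a →
    (∃[ j ] a j F.# F.0#) × eval (λ j → embed (a j)) x ≈ 0#

  -- The subfield of L generated by F and the elements of S.
  data Adjoin (S : Pred Carrier p) : Pred Carrier (c₁ ⊔ c₂ ⊔ ℓ₂ ⊔ p) where
    base : ∀ a → Adjoin S (embed a)
    gen  : ∀ {x} → S x → Adjoin S x
    add  : ∀ {x y} → Adjoin S x → Adjoin S y → Adjoin S (x + y)
    neg  : ∀ {x} → Adjoin S x → Adjoin S (- x)
    mul  : ∀ {x y} → Adjoin S x → Adjoin S y → Adjoin S (x * y)
    inv  : ∀ {x y} → Adjoin S x → x * y ≈ 1# → Adjoin S y
    resp : ∀ {x y} → x ≈ y → Adjoin S x → Adjoin S y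

IsNumberField : Field c ℓ ℓ′ → Set (c ⊔ ℓ)
IsNumberField K = Σ (Extension ℚ-field K) IsFinite

IsAlgebraicallyClosed : Field c ℓ ℓ′ → Set (c ⊔ ℓ ⊔ ℓ′)
IsAlgebraicallyClosed L =
  ∀ n (a : Vector Carrier (2 ℕ.+ n)) → a (fromℕ (1 ℕ.+ n)) # 0# →
  ∃[ x ] eval a x ≈ 0#
  where open Field L

IsAlgebraicClosure : {F : Field c₁ ℓ₁ ℓ₁′} {L : Field c₂ ℓ₂ ℓ₂′} →
                     Extension F L → Set (c₁ ⊔ ℓ₁′ ⊔ c₂ ⊔ ℓ₂ ⊔ ℓ₂′)
IsAlgebraicClosure {L = L} E = IsAlgebraicallyClosed L × IsAlgebraic E

-- The curve y² = x³ + bx, with its points rational over L.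
module Curve (L : Field c ℓ ℓ′) (b : Field.Carrier L) where
  open Field L

  OnCurve : Carrier → Carrier → Set ℓ
  OnCurve x y = y ^ 2 ≈ x ^ 3 + b * x

  data Point : Set (c ⊔ ℓ) where
    𝒪      : Point
    affine : ∀ x y → OnCurve x y → Point

  _≈ₚ_ : Point → Point → Set ℓ
  𝒪            ≈ₚ 𝒪              = Lift ℓ ⊤
  𝒪            ≈ₚ affine _ _ _   = Lift ℓ ⊥
  affine _ _ _ ≈ₚ 𝒪              = Lift ℓ ⊥
  affine x y _ ≈ₚ affine x′ y′ _ = x ≈ x′ × y ≈ y′

  -- The line of slope s through (x₁ , y₁) that meets the curve also at x₂
  -- meets it a third time at abscissa thirdX; (thirdX , thirdY) is the
  -- reflection of that third intersection in the x-axis.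
  thirdX : (s x₁ x₂ : Carrier) → Carrier
  thirdX s x₁ x₂ = s ^ 2 - x₁ - x₂

  thirdY : (s x₁ x₂ y₁ : Carrier) → Carrier
  thirdY s x₁ x₂ y₁ = s * (x₁ - thirdX s x₁ x₂) - y₁

  chord : ∀ {x₁ x₂} (y₁ y₂ : Carrier) → x₁ # x₂ → Carrier
  chord y₁ y₂ x₁#x₂ = (y₁ - y₂) * ⟨ x₁#x₂ ⟩⁻¹

  -- Used when x₁ ≈ x₂ and y₁ ≉ - y₂; then y₁ ≈ y₂, and the inverted element
  -- y₁ - - y₂ is 2y₁.
  tangent : ∀ (x₁ : Carrier) {y₁ y₂} → y₁ # - y₂ → Carrier
  tangent x₁ y₁#-y₂ = (3 · (x₁ ^ 2) + b) * ⟨ y₁#-y₂ ⟩⁻¹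

  private
    open IntegerCoefficientSolver L
    open SetoidReasoning setoid

    ⟨⟩⁻¹-inverseˡ : ∀ {x y} (x#y : x # y) → ⟨ x#y ⟩⁻¹ * (x - y) ≈ 1#
    ⟨⟩⁻¹-inverseˡ x#y = proj₁ (proj₂ (#⇒invertible x#y))

    -- x³ + bx - (y₁ + s (x - x₁))²
    --   = (x - x₁) (x - x₂) (x - x₃) + coefficient · (x - x₁) + (x₁³ + bx₁ - y₁²)
    coefficient : (s x₁ x₂ y₁ : Carrier) → Carrier
    coefficient s x₁ x₂ y₁ =
      b - 2 · (s * (y₁ - s * x₁)) - (x₁ * x₂ + (x₁ + x₂) * thirdX s x₁ x₂)

    x-y≈0 : ∀ {x y} → x ≈ y → x - y ≈ 0#
    x-y≈0 {x} {y} x≈y = trans (+-congʳ x≈y) (-‿inverseʳ y)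

    x-y≈0⇒x≈y : ∀ {x y} → x - y ≈ 0# → x ≈ y
    x-y≈0⇒x≈y {x} {y} eq = begin
      x            ≈⟨ solve 2 (λ x y → x := (x :- y) :+ y) refl x y ⟩
      x - y + y    ≈⟨ +-congʳ eq ⟩
      0# + y       ≈⟨ +-identityˡ y ⟩
      y            ∎

    cancel : ∀ {x y z} (x#y : x # y) → z * (x - y) ≈ 0# → z ≈ 0#
    cancel {x} {y} {z} x#y eq = begin
      z                   ≈⟨ *-identityʳ z ⟨
      z * 1#              ≈⟨ *-congˡ (⟨⟩⁻¹-inverseˡ x#y) ⟨
      z * (u * (x - y))   ≈⟨ solve 3 (λ z u d → z :* (u :* d) := u :* (z :* d)) refl z u (x - y) ⟩
      u * (z * (x - y))   ≈⟨ *-congˡ eq ⟩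
      u * 0#              ≈⟨ zeroʳ u ⟩
      0#                  ∎
      where u = ⟨ x#y ⟩⁻¹

    slope : ∀ {x y} z (x#y : x # y) → z * ⟨ x#y ⟩⁻¹ * (x - y) ≈ z
    slope z x#y =
      trans (*-assoc _ _ _) (trans (*-congˡ (⟨⟩⁻¹-inverseˡ x#y)) (*-identityʳ z))

    third-onCurve : ∀ s x₁ x₂ y₁ → OnCurve x₁ y₁ → coefficient s x₁ x₂ y₁ ≈ 0# →
                    OnCurve (thirdX s x₁ x₂) (thirdY s x₁ x₂ y₁)
    third-onCurve s x₁ x₂ y₁ on₁ α≈0 = x-y≈0⇒x≈y (begin
      y₃ ^ 2 - (x₃ ^ 3 + b * x₃)
        ≈⟨ solve 5 (λ b s x₁ x₂ y₁ →
             let x₃ = s :^ 2 :- x₁ :- x₂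
                 y₃ = s :* (x₁ :- x₃) :- y₁
                 α  = b :- 2 :× (s :* (y₁ :- s :* x₁)) :- (x₁ :* x₂ :+ (x₁ :+ x₂) :* x₃)
             in y₃ :^ 2 :- (x₃ :^ 3 :+ b :* x₃)
                := α :* (x₁ :- x₃) :+ (y₁ :^ 2 :- (x₁ :^ 3 :+ b :* x₁)))
             refl b s x₁ x₂ y₁ ⟩
      coefficient s x₁ x₂ y₁ * (x₁ - x₃) + (y₁ ^ 2 - (x₁ ^ 3 + b * x₁))
        ≈⟨ +-cong (trans (*-congʳ α≈0) (zeroˡ _)) (x-y≈0 on₁) ⟩
      0# + 0#
        ≈⟨ +-identityˡ 0# ⟩
      0# ∎)
      where
      x₃ = thirdX s x₁ x₂
      y₃ = thirdY s x₁ x₂ y₁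

  chord-onCurve : ∀ {x₁ y₁ x₂ y₂} → OnCurve x₁ y₁ → OnCurve x₂ y₂ → (x₁#x₂ : x₁ # x₂) →
                  let s = chord y₁ y₂ x₁#x₂
                  in OnCurve (thirdX s x₁ x₂) (thirdY s x₁ x₂ y₁)
  chord-onCurve {x₁} {y₁} {x₂} {y₂} on₁ on₂ x₁#x₂ =
    third-onCurve s x₁ x₂ y₁ on₁ (cancel x₁#x₂ (begin
      coefficient s x₁ x₂ y₁ * (x₁ - x₂)
        ≈⟨ solve 5 (λ b s x₁ x₂ y₁ →
             let x₃ = s :^ 2 :- x₁ :- x₂
                 α  = b :- 2 :× (s :* (y₁ :- s :* x₁)) :- (x₁ :* x₂ :+ (x₁ :+ x₂) :* x₃)
             in α :* (x₁ :- x₂)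
                := (y₁ :- s :* (x₁ :- x₂)) :^ 2 :- (x₂ :^ 3 :+ b :* x₂)
                   :- (y₁ :^ 2 :- (x₁ :^ 3 :+ b :* x₁)))
             refl b s x₁ x₂ y₁ ⟩
      (y₁ - s * (x₁ - x₂)) ^ 2 - (x₂ ^ 3 + b * x₂) - (y₁ ^ 2 - (x₁ ^ 3 + b * x₁))
        ≈⟨ +-cong (x-y≈0 (trans (^-congˡ 2 y₂≈) on₂)) (-‿cong (x-y≈0 on₁)) ⟩
      0# - 0#
        ≈⟨ -‿inverseʳ 0# ⟩
      0# ∎))
    where
    s = chord y₁ y₂ x₁#x₂
    y₂≈ : y₁ - s * (x₁ - x₂) ≈ y₂
    y₂≈ = begin
      y₁ - s * (x₁ - x₂)   ≈⟨ +-congˡ (-‿cong (slope (y₁ - y₂) x₁#x₂)) ⟩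
      y₁ - (y₁ - y₂)       ≈⟨ solve 2 (λ y₁ y₂ → y₁ :- (y₁ :- y₂) := y₂) refl y₁ y₂ ⟩
      y₂                   ∎

  tangent-onCurve : ∀ {x₁ y₁ x₂ y₂} → OnCurve x₁ y₁ → OnCurve x₂ y₂ → x₁ ≈ x₂ →
                    (y₁#-y₂ : y₁ # - y₂) →
                    let s = tangent x₁ y₁#-y₂
                    in OnCurve (thirdX s x₁ x₂) (thirdY s x₁ x₂ y₁)
  tangent-onCurve {x₁} {y₁} {x₂} {y₂} on₁ on₂ x₁≈x₂ y₁#-y₂ =
    third-onCurve s x₁ x₂ y₁ on₁ (begin
      coefficient s x₁ x₂ y₁
        ≈⟨ +-congˡ (-‿cong (+-cong (*-congˡ x₂≈x₁)
             (*-cong (+-congˡ x₂≈x₁) (+-congˡ (-‿cong x₂≈x₁))))) ⟩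
      coefficient s x₁ x₁ y₁
        ≈⟨ solve 4 (λ b s x₁ y₁ →
             let x₃ = s :^ 2 :- x₁ :- x₁
             in b :- 2 :× (s :* (y₁ :- s :* x₁)) :- (x₁ :* x₁ :+ (x₁ :+ x₁) :* x₃)
                := 3 :× (x₁ :^ 2) :+ b :- s :* (y₁ :- :- y₁))
             refl b s x₁ y₁ ⟩
      3 · (x₁ ^ 2) + b - s * (y₁ - - y₁)
        ≈⟨ +-congˡ (-‿cong (*-congˡ (+-congˡ (-‿cong (-‿cong y₁≈y₂))))) ⟩
      3 · (x₁ ^ 2) + b - s * (y₁ - - y₂)
        ≈⟨ +-congˡ (-‿cong (slope (3 · (x₁ ^ 2) + b) y₁#-y₂)) ⟩
      3 · (x₁ ^ 2) + b - (3 · (x₁ ^ 2) + b)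
        ≈⟨ -‿inverseʳ _ ⟩
      0# ∎)
    where
    s = tangent x₁ y₁#-y₂
    x₂≈x₁ = sym x₁≈x₂
    y₁≈y₂ : y₁ ≈ y₂
    y₁≈y₂ = x-y≈0⇒x≈y (cancel y₁#-y₂ (begin
      (y₁ - y₂) * (y₁ - - y₂)
        ≈⟨ solve 2 (λ y₁ y₂ → (y₁ :- y₂) :* (y₁ :- :- y₂) := y₁ :^ 2 :- y₂ :^ 2) refl y₁ y₂ ⟩
      y₁ ^ 2 - y₂ ^ 2
        ≈⟨ +-cong on₁ (-‿cong on₂) ⟩
      x₁ ^ 3 + b * x₁ - (x₂ ^ 3 + b * x₂)
        ≈⟨ x-y≈0 (+-cong (^-congˡ 3 x₁≈x₂) (*-congˡ x₁≈x₂)) ⟩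
      0# ∎))

  _⊕_ : Point → Point → Point
  𝒪                ⊕ Q                = Q
  P@(affine _ _ _) ⊕ 𝒪                = P
  affine x₁ y₁ on₁ ⊕ affine x₂ y₂ on₂ with x₁ #? x₂ | y₁ #? (- y₂)
  ... | yes x₁#x₂ | _          = affine _ _ (chord-onCurve on₁ on₂ x₁#x₂)
  ... | no ¬x₁#x₂ | yes y₁#-y₂ =
    affine _ _ (tangent-onCurve on₁ on₂ (proj₁ (tight x₁ x₂) ¬x₁#x₂) y₁#-y₂)
  ... | no _      | no _       = 𝒪

  rawMonoid : RawMonoid (c ⊔ ℓ) ℓ
  rawMonoid = record { _≈_ = _≈ₚ_ ; _∙_ = _⊕_ ; ε = 𝒪 }

  open RawMonoidDefinitions rawMonoid public
    using () renaming (_×_ to _×ₚ_)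

  IsTorsion : ℕ → Pred Point ℓ
  IsTorsion n P = (n ×ₚ P) ≈ₚ 𝒪

  TorsionCoordinate : ℕ → Pred Carrier (c ⊔ ℓ)
  TorsionCoordinate n z =
    ∃[ x ] ∃[ y ] Σ (OnCurve x y) λ on →
    IsTorsion n (affine x y on) × (z ≈ x ⊎ z ≈ y)

module _ {K : Field c₁ ℓ₁ ℓ₁′} {K̄ : Field c₂ ℓ₂ ℓ₂′} (E : Extension K K̄) where

  -- K(ℰ[n]) for the curve ℰ : y² = x³ + bx over K, inside K̄.
  TorsionField : Field.Carrier K → ℕ → Pred (Field.Carrier K̄) (c₁ ⊔ c₂ ⊔ ℓ₂)
  TorsionField b n = Adjoin E (Curve.TorsionCoordinate K̄ (Extension.embed E b) n)

module _ (L : Field c ℓ ℓ′) where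
  open Field L

  θ₁ : (i ζ₅ : Carrier) → Carrier
  θ₁ i ζ₅ = - ((- (4 · i) + 4 · 1#) * ζ₅ ^ 3 + 4 · (ζ₅ ^ 2) - 4 · (i * ζ₅) - 2 · i + 5 · 1#)

-- Let P = (s , w) with s² = θ₁b and w² = (θ₁ + 1)bs.  The curve has complex multiplication
-- by i, acting as (x , y) ↦ (- x , iy), and for α ∈ ℤ[i] the coordinates of αP are fs and
-- gw with f , g ∈ ℚ(i , ζ₅).  With 2P = (fs , gw) one finds 3P = (fs , - gw), so that P is
-- a 5-torsion point; hence w and i = (iw)/w lie in K₅, and so does ζ₅, which is a cubic
-- polynomial in θ₁ = s²/b over ℚ(i).  Conversely, if 5Q = 𝒪 then 3Q = - 2Q, which says that
-- X = x(Q)² is a root of the 5-division polynomial; this splits over ℤ[i , ζ₅] into six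
-- linear factors nX - ub, one for each class of nonzero α ∈ ℤ[i]/5 modulo units, and for
-- each of them the coordinates of αP are compared with those of Q.
module Submission where

open import Defs
import Algebra.Bundles.Raw as Raw
open import Algebra.Morphism.Structures using (module RingMorphisms)
import Algebra.Properties.Ring as RingProperties
import Algebra.Properties.Semiring.Mult as SemiringMult
import Algebra.Solver.Ring as RingSolver
import Algebra.Solver.Ring.AlmostCommutativeRing as ACR
open import Data.Empty using (⊥-elim)
open import Data.Integer.Base using (ℤ; +_; -[1+_])
import Data.Integer.Literals as ℤ
import Data.Integer.Properties as ℤ
open import Data.List.Base using (List; []; _∷_; foldr)
open import Data.List.Relation.Unary.All as All using (All; []; _∷_)
open import Data.List.Relation.Unary.Any as Any using (Any; here; there)
open import Data.Maybe.Base using (Maybe; just; nothing)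
import Data.Nat.Literals as ℕ
open import Data.Nat.Base using (ℕ; zero; suc; z≤n; s≤s)
open import Data.Product.Base using (∃-syntax; _×_; _,_; proj₁; proj₂)
open import Data.Product.Properties using (≡-dec)
open import Data.Rational.Base as ℚ using (0ℚ; 1ℚ)
import Data.Rational.Properties as ℚ
open import Data.Sum.Base using (_⊎_; inj₁; inj₂; [_,_]; map)
-- tt is the instance argument of the overloaded literals.
open import Data.Unit.Base using (tt)
open import Function.Base using (_∘_)
open import Level using (Level; _⊔_; 0ℓ)
open import Relation.Binary.Definitions using (DecidableEquality)
open import Relation.Binary.PropositionalEquality.Core as ≡ using (_≡_)
import Relation.Binary.Reasoning.Setoid as SetoidReasoning
open import Relation.Nullary.Decidable.Core using (yes; no)
open import Relation.Nullary.Negation.Core using (¬_)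
open import Relation.Unary using (Pred; _⊆_; _≐_; _∪_)

private
  variable
    c ℓ ℓ′ c₁ ℓ₁ ℓ₁′ c₂ ℓ₂ ℓ₂′ p p₁ p₂ : Level

-- Quadratic extensions of rings of coefficients

-- R[t] / (t² - pt - q), the pair (x , y) standing for x + yt.
quadratic : (R : Raw.RawRing 0ℓ 0ℓ) (p q : Raw.RawRing.Carrier R) → Raw.RawRing 0ℓ 0ℓ
quadratic R p q = record
  { Carrier = Carrier × Carrier
  ; _≈_     = _≡_
  ; _+_     = λ (x , y) (z , w) → x + z , y + w
  ; _*_     = λ (x , y) (z , w) → x * z + q * (y * w) , x * w + y * z + p * (y * w)
  ; -_      = λ (x , y) → - x , - y
  ; 0#      = 0# , 0#
  ; 1#      = 1# , 0#
  }
  where open Raw.RawRing R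

module QuadraticLift (L : Field c ℓ ℓ′) where
  open Field L
  open IntegerCoefficientSolver L
  open SetoidReasoning setoid

  -- Certificate for an equality modulo a relation: `z` is the cofactor of `p - q`, and what remains
  -- is a polynomial identity for the solver. Nested uses handle several relations, each with its
  -- own cofactor.
  modulo : ∀ {x y z p q} → p ≈ q → x ≈ y + z * (p - q) → x ≈ y
  modulo {x} {y} {z} {p} {q} p≈q eq = begin
    x                ≈⟨ eq ⟩
    y + z * (p - q)  ≈⟨ +-congˡ (*-congˡ (+-congʳ p≈q)) ⟩
    y + z * (q - q)  ≈⟨ solve 3 (λ y z q → y :+ z :* (q :- q) := y) refl y z q ⟩
    y                ∎

  infix 4 _⟶L
  _⟶L : Raw.RawRing 0ℓ 0ℓ → Set _
  R ⟶L = R ACR.-Raw-AlmostCommutative⟶ almostCommutativeRing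

  module _ {R : Raw.RawRing 0ℓ 0ℓ} (φ : R ⟶L) where
    private
      module R = Raw.RawRing R
      module φ = ACR._-Raw-AlmostCommutative⟶_ φ
    open φ using (⟦_⟧)

    value : Carrier → R.Carrier × R.Carrier → Carrier
    value t (x , y) = ⟦ x ⟧ + ⟦ y ⟧ * t

    value-const : ∀ t x → value t (x , R.0#) ≈ ⟦ x ⟧
    value-const t x = begin
      ⟦ x ⟧ + ⟦ R.0# ⟧ * t ≈⟨ +-congˡ (*-congʳ φ.0-homo) ⟩
      ⟦ x ⟧ + 0# * t       ≈⟨ +-congˡ (zeroˡ t) ⟩
      ⟦ x ⟧ + 0#           ≈⟨ +-identityʳ _ ⟩
      ⟦ x ⟧                ∎

    value-root : ∀ t → value t (R.0# , R.1#) ≈ t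
    value-root t = begin
      ⟦ R.0# ⟧ + ⟦ R.1# ⟧ * t ≈⟨ +-cong φ.0-homo (*-congʳ φ.1-homo) ⟩
      0# + 1# * t             ≈⟨ +-identityˡ _ ⟩
      1# * t                  ≈⟨ *-identityˡ t ⟩
      t                       ∎

    -- Universal property of the quotient by t² - pt - q. In the product only ywt² has to be
    -- rewritten, as yw(pt + q).
    lift : ∀ p q {t} → t * t ≈ ⟦ p ⟧ * t + ⟦ q ⟧ → quadratic R p q ⟶L
    lift p q {t} root = record
      { ⟦_⟧    = value t
      ; +-homo = λ (x , y) (z , w) → begin
          ⟦ x R.+ z ⟧ + ⟦ y R.+ w ⟧ * t
            ≈⟨ +-cong (φ.+-homo x z) (*-congʳ (φ.+-homo y w)) ⟩
          ⟦ x ⟧ + ⟦ z ⟧ + (⟦ y ⟧ + ⟦ w ⟧) * t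
            ≈⟨ solve 5 (λ x y z w t → x :+ z :+ (y :+ w) :* t := x :+ y :* t :+ (z :+ w :* t))
                 refl ⟦ x ⟧ ⟦ y ⟧ ⟦ z ⟧ ⟦ w ⟧ t ⟩
          value t (x , y) + value t (z , w) ∎
      ; *-homo = λ (x , y) (z , w) → begin
          ⟦ x R.* z R.+ q R.* (y R.* w) ⟧ + ⟦ x R.* w R.+ y R.* z R.+ p R.* (y R.* w) ⟧ * t
            ≈⟨ +-cong (plus (prod′ x z) (prod q (prod′ y w)))
                 (*-congʳ (plus (plus (prod′ x w) (prod′ y z)) (prod p (prod′ y w)))) ⟩
          ⟦ x ⟧ * ⟦ z ⟧ + ⟦ q ⟧ * (⟦ y ⟧ * ⟦ w ⟧)
            + (⟦ x ⟧ * ⟦ w ⟧ + ⟦ y ⟧ * ⟦ z ⟧ + ⟦ p ⟧ * (⟦ y ⟧ * ⟦ w ⟧)) * t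
            ≈⟨ modulo (sym root) (solve 7 (λ x y z w p q t →
                 x :* z :+ q :* (y :* w) :+ (x :* w :+ y :* z :+ p :* (y :* w)) :* t
                 := (x :+ y :* t) :* (z :+ w :* t) :+ y :* w :* (p :* t :+ q :- t :* t))
                 refl ⟦ x ⟧ ⟦ y ⟧ ⟦ z ⟧ ⟦ w ⟧ ⟦ p ⟧ ⟦ q ⟧ t) ⟩
          value t (x , y) * value t (z , w) ∎
      ; -‿homo = λ (x , y) → begin
          ⟦ R.- x ⟧ + ⟦ R.- y ⟧ * t  ≈⟨ +-cong (φ.-‿homo x) (*-congʳ (φ.-‿homo y)) ⟩
          - ⟦ x ⟧ + - ⟦ y ⟧ * t
            ≈⟨ solve 3 (λ x y t → :- x :+ (:- y) :* t := :- (x :+ y :* t)) refl ⟦ x ⟧ ⟦ y ⟧ t ⟩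
          - value t (x , y)          ∎
      ; 0-homo = trans (value-const t R.0#) φ.0-homo
      ; 1-homo = trans (value-const t R.1#) φ.1-homo
      }
      where
      plus : ∀ {x y u v} → ⟦ x ⟧ ≈ u → ⟦ y ⟧ ≈ v → ⟦ x R.+ y ⟧ ≈ u + v
      plus {x} {y} eq₁ eq₂ = trans (φ.+-homo x y) (+-cong eq₁ eq₂)
      prod : ∀ x {y v} → ⟦ y ⟧ ≈ v → ⟦ x R.* y ⟧ ≈ ⟦ x ⟧ * v
      prod x {y} eq = trans (φ.*-homo x y) (*-congˡ eq)
      prod′ : ∀ x y → ⟦ x R.* y ⟧ ≈ ⟦ x ⟧ * ⟦ y ⟧
      prod′ = φ.*-homo

-- The ring ℤ[i, ζ₅]

-- ζ₅ is quadratic over ℤ[η] for η = ζ₅ + ζ₅⁻¹: η² = 1 - η and ζ₅² = ηζ₅ - 1.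
ℤ[i] ℤ[i,η] ℤ[i,ζ] : Raw.RawRing 0ℓ 0ℓ
ℤ[i]   = quadratic ℤ.+-*-rawRing (+ 0) (ℤ.- + 1)
  where import Data.Integer.Base as ℤ
ℤ[i,η] = quadratic ℤ[i] (- 1#) 1#
  where open Raw.RawRing ℤ[i]
ℤ[i,ζ] = quadratic ℤ[i,η] (Raw.RawRing.0# ℤ[i] , Raw.RawRing.1# ℤ[i]) (- 1#)
  where open Raw.RawRing ℤ[i,η]

module Cyclotomic where
  open import Agda.Builtin.FromNat using (Number; fromNat)
  open import Agda.Builtin.FromNeg using (Negative; fromNeg)
  instance
    ℕ-number : Number ℕ
    ℕ-number = ℕ.number
    ℤ-number : Number ℤ
    ℤ-number = ℤ.number
    ℤ-negative : Negative ℤ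
    ℤ-negative = ℤ.negative

  module ℤi = Raw.RawRing ℤ[i]
  open Raw.RawRing ℤ[i,ζ] public

  _≟_ : DecidableEquality Carrier
  _≟_ = ≡-dec (≡-dec ≟i ≟i) (≡-dec ≟i ≟i)
    where
    ≟i : DecidableEquality ℤi.Carrier
    ≟i = ≡-dec ℤ._≟_ ℤ._≟_

  gaussian : ℤi.Carrier → Carrier
  gaussian x = (x , ℤi.0#) , (ℤi.0# , ℤi.0#)

  integer : ℤ → Carrier
  integer n = gaussian (n , + 0)

  -- x₀ + x₁ζ + x₂ζ² + x₃ζ³, with ζ² = ηζ - 1 and ζ³ = - η - ηζ.
  ∑ζ : (x₀ x₁ x₂ x₃ : ℤi.Carrier) → Carrier
  ∑ζ x₀ x₁ x₂ x₃ = (x₀ ℤi.+ ℤi.- x₂ , ℤi.- x₃) , (x₁ , x₂ ℤi.+ ℤi.- x₃)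

  -- θ is θ₁, and (fs , gw) is the double of (s , w).
  ζ θ θ⁻¹ θ+1 2/⟨θ+1⟩ f g 1-f 2/⟨1-f⟩ : Carrier
  ζ        = ∑ζ (0 , 0) (1 , 0) (0 , 0) (0 , 0)
  θ        = ∑ζ (-5 , 2) (0 , 4) (-4 , 0) (-4 , 4)
  θ⁻¹      = ∑ζ (7 , -10) (0 , -20) (-12 , -16) (-12 , -4)
  θ+1      = θ + 1#
  2/⟨θ+1⟩  = ∑ζ (-2 , -1) (0 , -2) (-2 , 0) (-2 , -2)
  f        = ∑ζ (3 , -2) (0 , -4) (-2 , -4) (-2 , 0)
  g        = ∑ζ (-5 , 0) (0 , 0) (-1 , 3) (-1 , -3)
  1-f      = 1# + - f
  2/⟨1-f⟩  = ∑ζ (1 , 0) (0 , 0) (0 , 1) (0 , -1)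

  -- 64ζ = a₀ + a₁θ + a₂θ² + a₃θ³
  a₀ a₁ a₂ a₃ : ℤi.Carrier
  a₀ = 19 , 60
  a₁ = 41 , 46
  a₂ = -11 , -24
  a₃ = -1 , -2

  -- The factor nX - ub of the 5-division polynomial in X = x²; a point (x , y) with nx² = ub
  -- satisfies hx = ± s, and ky = ± w or ± iw.
  record Factor : Set where
    constructor factor
    field n n̄ u h k : Carrier

  -- The points αP for α = 1, 2, 1 + i, 2 + 2i, 2 + i, 2 - i.
  F₁ F₂ F₃ F₄ F₅ F₆ : Factor
  F₁ = factor 1# (integer 5) θ 1# 1#
  F₂ = factor 1# (integer 5)
        (∑ζ (-5 , -2) (0 , -4) (-4 , 0) (-4 , -4))
        (∑ζ (3 , 2) (0 , 4) (-2 , 4) (-2 , 0))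
        (∑ζ (5 , 0) (0 , 0) (1 , 3) (1 , -3))
  F₃ = factor 1# (integer 5)
        (∑ζ (-1 , 2) (0 , 4) (4 , 4) (4 , 0))
        (∑ζ (-1 , 4) (-2 , 0) (0 , 2) (-2 , 2))
        (∑ζ (-2 , 1) (-1 , -1) (-1 , -1) (0 , 0))
  F₄ = factor 1# (integer 5)
        (∑ζ (-1 , -2) (0 , -4) (4 , -4) (4 , 0))
        (∑ζ (3 , 10) (6 , 0) (-2 , 6) (8 , 6))
        (∑ζ (-3 , 6) (3 , 3) (-4 , 2) (1 , 7))
  F₅ = factor (gaussian (1 , 2)) (gaussian (1 , -2)) (- 1#)
        (∑ζ (1 , 0) (0 , -2) (0 , 0) (2 , -2))
        (∑ζ (1 , 4) (1 , 1) (-2 , 2) (2 , 2))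
  F₆ = factor (gaussian (1 , -2)) (gaussian (1 , 2)) (- 1#)
        (∑ζ (1 , -2) (0 , -2) (2 , 0) (0 , -2))
        (∑ζ (0 , -3) (-1 , 1) (1 , -1) (-3 , -1))

  factors : List Factor
  factors = F₁ ∷ F₂ ∷ F₃ ∷ F₄ ∷ F₅ ∷ F₆ ∷ []

  -- With nx² = ub and s² = θb the second equation gives (hx)² = s²; with y² = x³ + bx the third
  -- gives (ky)² = (θ + 1)b · hx. The first makes `n` invertible wherever 5 is.
  record IsCompatible (F : Factor) : Set where
    constructor checked
    open Factor F
    field
      nn̄≡5          : n * n̄ ≡ integer 5
      h²u≡nθ        : h * h * u ≡ n * θ
      k²[u+n]≡nhθ+1 : k * k * (u + n) ≡ n * h * θ+1

  -- Both sides of each equation are closed elements of ℤ[i, ζ], that is eight integers, so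
  -- evaluation suffices.
  factors-compatible : All IsCompatible factors
  factors-compatible
    = checked ≡.refl ≡.refl ≡.refl ∷ checked ≡.refl ≡.refl ≡.refl
    ∷ checked ≡.refl ≡.refl ≡.refl ∷ checked ≡.refl ≡.refl ≡.refl
    ∷ checked ≡.refl ≡.refl ≡.refl ∷ checked ≡.refl ≡.refl ≡.refl ∷ []

-- Invertible elements of a field

module Units (L : Field c ℓ ℓ′) where
  open Field L
  open IntegerCoefficientSolver L
  open SetoidReasoning setoid

  Unit : Pred Carrier (c ⊔ ℓ)
  Unit a = ∃[ a′ ] a * a′ ≈ 1#

  unit-resp : ∀ {a b} → a ≈ b → Unit a → Unit b
  unit-resp a≈b (a′ , aa′≈1) = a′ , trans (*-congʳ (sym a≈b)) aa′≈1

  unit-1 : Unit 1#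
  unit-1 = 1# , *-identityˡ 1#

  unit-* : ∀ {a b} → Unit a → Unit b → Unit (a * b)
  unit-* {a} {b} (a′ , aa′≈1) (b′ , bb′≈1) = a′ * b′ , (begin
    a * b * (a′ * b′)    ≈⟨ solve 4 (λ a b a′ b′ → a :* b :* (a′ :* b′) := a :* a′ :* (b :* b′))
                              refl a b a′ b′ ⟩
    a * a′ * (b * b′)    ≈⟨ *-cong aa′≈1 bb′≈1 ⟩
    1# * 1#              ≈⟨ *-identityˡ 1# ⟩
    1#                   ∎)

  unit-factorˡ : ∀ a {b} → Unit (a * b) → Unit a
  unit-factorˡ a {b} (c , abc≈1) = b * c , trans (sym (*-assoc a b c)) abc≈1

  unit-root : ∀ a {b} → a * a ≈ b → Unit b → Unit a
  unit-root a a²≈b = unit-factorˡ a ∘ unit-resp (sym a²≈b)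

  unit-square-factor : ∀ a {b c} → a * a * b ≈ c → Unit c → Unit a
  unit-square-factor a a²b≈c u =
    unit-factorˡ a (unit-factorˡ (a * a) (unit-resp (sym a²b≈c) u))

  unit-cancel : ∀ {a x y} → Unit a → a * x ≈ a * y → x ≈ y
  unit-cancel {a} {x} {y} (a′ , aa′≈1) ax≈ay = begin
    x               ≈⟨ recover x ⟨
    a′ * (a * x)    ≈⟨ *-congˡ ax≈ay ⟩
    a′ * (a * y)    ≈⟨ recover y ⟩
    y               ∎
    where
    recover : ∀ z → a′ * (a * z) ≈ z
    recover z = begin
      a′ * (a * z)  ≈⟨ solve 3 (λ a a′ z → a′ :* (a :* z) := a :* a′ :* z) refl a a′ z ⟩
      a * a′ * z    ≈⟨ *-congʳ aa′≈1 ⟩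
      1# * z        ≈⟨ *-identityˡ z ⟩
      z             ∎

  unit-double : ∀ {x} → Unit (2 · 1#) → Unit x → Unit (x - - x)
  unit-double {x} u₂ u =
    unit-resp (solve 1 (λ x → con (+ 2) :* x := x :- :- x) refl x) (unit-* u₂ u)

  #⇒unit : ∀ {x y} → x # y → Unit (x - y)
  #⇒unit x#y with y , _ , xy≈1 ← #⇒invertible x#y = y , xy≈1

  unit⇒# : ∀ {x y} → Unit (x - y) → x # y
  unit⇒# (z , eq) = invertible⇒# (z , trans (*-comm _ _) eq , eq)

  unit⇒≉ : ∀ {x y} → Unit (x - y) → x ≉ y
  unit⇒≉ u x≈y = #-irrefl x≈y (unit⇒# u)

  ¬#⇒≈ : ∀ {x y} → ¬ (x # y) → x ≈ y
  ¬#⇒≈ {x} {y} = proj₁ (tight x y)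

  x-0≈x : ∀ x → x - 0# ≈ x
  x-0≈x x = solve 1 (λ x → x :- con (+ 0) := x) refl x

  unit-or-zero : ∀ x → Unit x ⊎ x ≈ 0#
  unit-or-zero x with x #? 0#
  ... | yes x#0 = inj₁ (unit-resp (x-0≈x x) (#⇒unit x#0))
  ... | no ¬x#0 = inj₂ (¬#⇒≈ ¬x#0)

  ≉0⇒unit : ∀ {x} → x ≉ 0# → Unit x
  ≉0⇒unit {x} x≉0 = [ (λ u → u) , ⊥-elim ∘ x≉0 ] (unit-or-zero x)

  1≉0 : 1# ≉ 0#
  1≉0 = unit⇒≉ (unit-resp (sym (x-0≈x 1#)) unit-1)

  x-y≈0⇒x≈y : ∀ {x y} → x - y ≈ 0# → x ≈ y
  x-y≈0⇒x≈y {x} {y} eq = begin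
    x            ≈⟨ solve 2 (λ x y → x := (x :- y) :+ y) refl x y ⟩
    x - y + y    ≈⟨ +-congʳ eq ⟩
    0# + y       ≈⟨ +-identityˡ y ⟩
    y            ∎

  zero-product : ∀ {x y} → x * y ≈ 0# → x ≈ 0# ⊎ y ≈ 0#
  zero-product {x} {y} xy≈0 with unit-or-zero x
  ... | inj₁ u   = inj₂ (unit-cancel u (trans xy≈0 (sym (zeroʳ x))))
  ... | inj₂ x≈0 = inj₁ x≈0

  -- The fold ends in a general `e` because the last factor will be the image of 1 under a
  -- coefficient map, not `1#` itself.
  product-zero : ∀ {a} {A : Set a} {e} (t : A → Carrier) (xs : List A) → e ≉ 0# →
                 foldr (λ x → t x *_) e xs ≈ 0# → Any (λ x → t x ≈ 0#) xs
  product-zero t []       e≉0 e≈0 = ⊥-elim (e≉0 e≈0)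
  product-zero t (x ∷ xs) e≉0 eq  with zero-product eq
  ... | inj₁ tx≈0 = here tx≈0
  ... | inj₂ rest = there (product-zero t xs e≉0 rest)

  square-roots : ∀ {x y} → x * x ≈ y * y → x ≈ y ⊎ x ≈ - y
  square-roots {x} {y} eq = map x-y≈0⇒x≈y x-y≈0⇒x≈y (zero-product (begin
    (x - y) * (x - - y)  ≈⟨ solve 2 (λ x y → (x :- y) :* (x :- :- y) := x :* x :- y :* y) refl x y ⟩
    x * x - y * y        ≈⟨ +-congʳ eq ⟩
    y * y - y * y        ≈⟨ -‿inverseʳ _ ⟩
    0#                   ∎))

-- Field extensions and adjunction

module _ {F : Field c₁ ℓ₁ ℓ₁′} {L : Field c₂ ℓ₂ ℓ₂′} (E : Extension F L) where
  private
    module F = Field F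
    module L = Field L
    module UF = Units F
    module UL = Units L
  open Extension E
  open RingMorphisms.IsRingHomomorphism embed-hom

  embed-unit : ∀ {a} → UF.Unit a → UL.Unit (embed a)
  embed-unit {a} (a′ , aa′≈1) =
    embed a′ , L.trans (L.sym (*-homo a a′)) (L.trans (⟦⟧-cong aa′≈1) 1#-homo)

  embed-natural : ∀ n → embed (n F.· F.1#) L.≈ n L.· L.1#
  embed-natural zero    = 0#-homo
  embed-natural (suc n) =
    L.trans (+-homo F.1# (n F.· F.1#)) (L.+-cong 1#-homo (embed-natural n))

  embed-natural-unit : ∀ n → UF.Unit (n F.· F.1#) → UL.Unit (n L.· L.1#)
  embed-natural-unit n u = UL.unit-resp (embed-natural n) (embed-unit u)

module _ {F : Field c₁ ℓ₁ ℓ₁′} {L : Field c₂ ℓ₂ ℓ₂′} {E : Extension F L} where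
  open Field L
  open Units L

  adjoin-least : {S : Pred Carrier p₁} {T : Pred Carrier p₂} →
                 S ⊆ Adjoin E T → Adjoin E S ⊆ Adjoin E T
  adjoin-least S⊆ (base a)     = base a
  adjoin-least S⊆ (gen x∈S)    = S⊆ x∈S
  adjoin-least S⊆ (add x y)    = add (adjoin-least S⊆ x) (adjoin-least S⊆ y)
  adjoin-least S⊆ (neg x)      = neg (adjoin-least S⊆ x)
  adjoin-least S⊆ (mul x y)    = mul (adjoin-least S⊆ x) (adjoin-least S⊆ y)
  adjoin-least S⊆ (inv x eq)   = inv (adjoin-least S⊆ x) eq
  adjoin-least S⊆ (resp eq x)  = resp eq (adjoin-least S⊆ x)

  adjoin-divide : {S : Pred Carrier p} → ∀ {a x y} → Unit a → a * x ≈ y →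
                  Adjoin E S a → Adjoin E S y → Adjoin E S x
  adjoin-divide {a = a} {x} {y} u@(a′ , aa′≈1) ax≈y a∈ y∈ =
    resp (unit-cancel u (begin
      a * (a′ * y)  ≈⟨ *-assoc a a′ y ⟨
      a * a′ * y    ≈⟨ *-congʳ aa′≈1 ⟩
      1# * y        ≈⟨ *-identityˡ y ⟩
      y             ≈⟨ ax≈y ⟨
      a * x         ∎)) (mul (inv a∈ aa′≈1) y∈)
    where open SetoidReasoning setoid

  module _ {S : Pred Carrier p} where
    open IntegerCoefficientSolver L using (fromℤ)
    open Extension E
    open RingMorphisms.IsRingHomomorphism embed-hom

    adjoin-0 : Adjoin E S 0#
    adjoin-0 = resp 0#-homo (base _)

    adjoin-1 : Adjoin E S 1#
    adjoin-1 = resp 1#-homo (base _)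

    adjoin-^ : ∀ n {x} → Adjoin E S x → Adjoin E S (x ^ n)
    adjoin-^ zero    x∈ = adjoin-1
    adjoin-^ (suc n) x∈ = mul x∈ (adjoin-^ n x∈)

    adjoin-natural : ∀ n → Adjoin E S (n · 1#)
    adjoin-natural zero    = adjoin-0
    adjoin-natural (suc n) = add adjoin-1 (adjoin-natural n)

    adjoin-integer : ∀ n → Adjoin E S (fromℤ n)
    adjoin-integer (+ n)      = adjoin-natural n
    adjoin-integer (-[1+ n ]) = neg (adjoin-natural (suc n))

-- Addition on the curve

module AdditionLaw (L : Field c ℓ ℓ′) (b : Field.Carrier L) where
  open Field L
  open Curve L b
  open Units L
  open QuadraticLift L using (modulo)
  open IntegerCoefficientSolver L
  open SemiringMult semiring using (×-congʳ)
  open RingProperties ring using (-‿involutive)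
  open SetoidReasoning setoid

  -- The graph of addition, with the slope given by an equation instead of a quotient and the
  -- condition of each case kept as data. The decisions inside `_⊕_` are met only in `⊕-Sum`.
  data Sum : (P Q R : Point) → Set (c ⊔ ℓ) where
    𝒪ˡ         : ∀ {Q} → Sum 𝒪 Q Q
    𝒪ʳ         : ∀ {x y on} → Sum (affine x y on) 𝒪 (affine x y on)
    distinct   : ∀ {x₁ y₁ on₁ x₂ y₂ on₂} s {on} → Unit (x₁ - x₂) → s * (x₁ - x₂) ≈ y₁ - y₂ →
                 Sum (affine x₁ y₁ on₁) (affine x₂ y₂ on₂)
                     (affine (thirdX s x₁ x₂) (thirdY s x₁ x₂ y₁) on)
    tangential : ∀ {x₁ y₁ on₁ x₂ y₂ on₂} s {on} → x₁ ≈ x₂ → Unit (y₁ - - y₂) →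
                 s * (y₁ - - y₂) ≈ 3 · (x₁ ^ 2) + b →
                 Sum (affine x₁ y₁ on₁) (affine x₂ y₂ on₂)
                     (affine (thirdX s x₁ x₂) (thirdY s x₁ x₂ y₁) on)
    opposite   : ∀ {x₁ y₁ on₁ x₂ y₂ on₂} → x₁ ≈ x₂ → y₁ ≈ - y₂ →
                 Sum (affine x₁ y₁ on₁) (affine x₂ y₂ on₂) 𝒪

  slope-equation : ∀ {x y} z (x#y : x # y) → z * ⟨ x#y ⟩⁻¹ * (x - y) ≈ z
  slope-equation z x#y = trans (*-assoc _ _ _)
    (trans (*-congˡ (proj₁ (proj₂ (#⇒invertible x#y)))) (*-identityʳ z))

  ⊕-Sum : ∀ P Q → Sum P Q (P ⊕ Q)
  ⊕-Sum 𝒪                Q                = 𝒪ˡ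
  ⊕-Sum (affine _ _ _)   𝒪                = 𝒪ʳ
  ⊕-Sum (affine x₁ y₁ _) (affine x₂ y₂ _) with x₁ #? x₂ | y₁ #? (- y₂)
  ... | yes x₁#x₂ | _          = distinct _ (#⇒unit x₁#x₂) (slope-equation (y₁ - y₂) x₁#x₂)
  ... | no ¬x₁#x₂ | yes y₁#-y₂ = tangential _ (¬#⇒≈ ¬x₁#x₂) (#⇒unit y₁#-y₂)
    (slope-equation (3 · (x₁ ^ 2) + b) y₁#-y₂)
  ... | no ¬x₁#x₂ | no ¬y₁#-y₂ = opposite (¬#⇒≈ ¬x₁#x₂) (¬#⇒≈ ¬y₁#-y₂)

  -- Leaves the proof of `OnCurve` free: `_⊕_` produces its own, for coordinates that are equal to
  -- the expected ones only up to `_≈_`.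
  data At (x y : Carrier) : Point → Set (c ⊔ ℓ) where
    at : ∀ {x′ y′ on} → x′ ≈ x → y′ ≈ y → At x y (affine x′ y′ on)

  -- The last two hypotheses are x₃ = λ² - x₁ - x₂ and y₃ = λ(x₁ - x₃) - y₁ for the slope λ = (y₁ -
  -- y₂)/(x₁ - x₂), cleared of denominators.
  sum-distinct : ∀ {P Q R x₁ y₁ x₂ y₂ x₃ y₃} → At x₁ y₁ P → At x₂ y₂ Q → Sum P Q R →
                 Unit (x₁ - x₂) →
                 (y₁ - y₂) * (y₁ - y₂) ≈ (x₁ - x₂) * (x₁ - x₂) * (x₁ + x₂ + x₃) →
                 (y₁ - y₂) * (x₁ - x₃) ≈ (x₁ - x₂) * (y₁ + y₃) →
                 At x₃ y₃ R
  sum-distinct {x₁ = x₁} {y₁} {x₂} {y₂} {x₃} {y₃} (at x₁′≈ y₁′≈) (at x₂′≈ y₂′≈)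
               (distinct {x₁ = x₁′} {y₁′} {x₂ = x₂′} s _ slope) u hx hy = at X≈x₃ (begin
      s * (x₁′ - thirdX s x₁′ x₂′) - y₁′
        ≈⟨ +-cong (*-congˡ (+-cong x₁′≈ (-‿cong X≈x₃))) (-‿cong y₁′≈) ⟩
      s * (x₁ - x₃) - y₁
        ≈⟨ unit-cancel u (modulo slope′ (modulo hy
             (solve 7 (λ x₁ y₁ x₂ y₂ x₃ y₃ s →
                (x₁ :- x₂) :* (s :* (x₁ :- x₃) :- y₁)
                := (x₁ :- x₂) :* y₃ :+ (x₁ :- x₃) :* (s :* (x₁ :- x₂) :- (y₁ :- y₂))
                   :+ con (+ 1) :* ((y₁ :- y₂) :* (x₁ :- x₃) :- (x₁ :- x₂) :* (y₁ :+ y₃)))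
              refl x₁ y₁ x₂ y₂ x₃ y₃ s))) ⟩
      y₃ ∎)
    where
    slope′ : s * (x₁ - x₂) ≈ y₁ - y₂
    slope′ = trans (*-congˡ (sym (+-cong x₁′≈ (-‿cong x₂′≈))))
               (trans slope (+-cong y₁′≈ (-‿cong y₂′≈)))
    X≈x₃ : thirdX s x₁′ x₂′ ≈ x₃
    X≈x₃ = begin
      s ^ 2 - x₁′ - x₂′
        ≈⟨ +-cong (+-congˡ (-‿cong x₁′≈)) (-‿cong x₂′≈) ⟩
      s ^ 2 - x₁ - x₂
        ≈⟨ unit-cancel (unit-* u u) (modulo slope′ (modulo hx
             (solve 6 (λ x₁ y₁ x₂ y₂ x₃ s →
                let d = x₁ :- x₂ ; e = y₁ :- y₂
                in d :* d :* (s :^ 2 :- x₁ :- x₂)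
                   := d :* d :* x₃ :+ (s :* d :+ e) :* (s :* d :- e)
                      :+ con (+ 1) :* (e :* e :- d :* d :* (x₁ :+ x₂ :+ x₃)))
              refl x₁ y₁ x₂ y₂ x₃ s))) ⟩
      x₃ ∎
  sum-distinct (at x₁′≈ _) (at x₂′≈ _) (tangential _ x₁′≈x₂′ _ _) u _ _ =
    ⊥-elim (unit⇒≉ u (trans (sym x₁′≈) (trans x₁′≈x₂′ x₂′≈)))
  sum-distinct (at x₁′≈ _) (at x₂′≈ _) (opposite x₁′≈x₂′ _) u _ _ =
    ⊥-elim (unit⇒≉ u (trans (sym x₁′≈) (trans x₁′≈x₂′ x₂′≈)))

  -- The denominators are cleared as for a chord; the slope is now e/d, with d = 2y₁ and e = 3x₁² +
  -- b.
  sum-tangential : ∀ {P Q R x₁ y₁ x₃ y₃} → At x₁ y₁ P → At x₁ y₁ Q → Sum P Q R →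
                   let d = y₁ - - y₁
                       e = x₁ * x₁ + x₁ * x₁ + x₁ * x₁ + b
                   in
                   Unit d → e * e ≈ d * d * (x₁ + x₁ + x₃) → e * (x₁ - x₃) ≈ d * (y₁ + y₃) →
                   At x₃ y₃ R
  sum-tangential (at x₁′≈ _) (at x₂′≈ _) (distinct _ u _) _ _ _ =
    ⊥-elim (unit⇒≉ u (trans x₁′≈ (sym x₂′≈)))
  sum-tangential {x₁ = x₁} {y₁} {x₃} {y₃} (at x₁′≈ y₁′≈) (at x₂′≈ y₂′≈)
                 (tangential {x₁ = x₁′} {y₁′} {x₂ = x₂′} s _ _ slope) u hx hy =
      at X≈x₃ (begin
      s * (x₁′ - thirdX s x₁′ x₂′) - y₁′
        ≈⟨ +-cong (*-congˡ (+-cong x₁′≈ (-‿cong X≈x₃))) (-‿cong y₁′≈) ⟩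
      s * (x₁ - x₃) - y₁
        ≈⟨ unit-cancel u (modulo slope′ (modulo hy
             (solve 6 (λ x₁ y₁ x₃ y₃ s b →
                let d = y₁ :- :- y₁ ; e = x₁ :* x₁ :+ x₁ :* x₁ :+ x₁ :* x₁ :+ b
                in d :* (s :* (x₁ :- x₃) :- y₁)
                   := d :* y₃ :+ (x₁ :- x₃) :* (s :* d :- e)
                      :+ con (+ 1) :* (e :* (x₁ :- x₃) :- d :* (y₁ :+ y₃)))
              refl x₁ y₁ x₃ y₃ s b))) ⟩
      y₃ ∎)
    where
    slope′ : s * (y₁ - - y₁) ≈ x₁ * x₁ + x₁ * x₁ + x₁ * x₁ + b
    slope′ = begin
      s * (y₁ - - y₁)                      ≈⟨ *-congˡ (+-cong y₁′≈ (-‿cong (-‿cong y₂′≈))) ⟨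
      _                                    ≈⟨ slope ⟩
      3 · (x₁′ ^ 2) + b                    ≈⟨ +-congʳ (×-congʳ 3 (^-congˡ 2 x₁′≈)) ⟩
      3 · (x₁ ^ 2) + b                     ≈⟨ solve 2 (λ x b →
                                                3 :× (x :^ 2) :+ b := x :* x :+ x :* x :+ x :* x :+ b)
                                                refl x₁ b ⟩
      x₁ * x₁ + x₁ * x₁ + x₁ * x₁ + b      ∎
    X≈x₃ : thirdX s x₁′ x₂′ ≈ x₃
    X≈x₃ = begin
      s ^ 2 - x₁′ - x₂′
        ≈⟨ +-cong (+-congˡ (-‿cong x₁′≈)) (-‿cong x₂′≈) ⟩
      s ^ 2 - x₁ - x₁
        ≈⟨ unit-cancel (unit-* u u) (modulo slope′ (modulo hx
             (solve 5 (λ x₁ y₁ x₃ s b →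
                let d = y₁ :- :- y₁ ; e = x₁ :* x₁ :+ x₁ :* x₁ :+ x₁ :* x₁ :+ b
                in d :* d :* (s :^ 2 :- x₁ :- x₁)
                   := d :* d :* x₃ :+ (s :* d :+ e) :* (s :* d :- e)
                      :+ con (+ 1) :* (e :* e :- d :* d :* (x₁ :+ x₁ :+ x₃)))
              refl x₁ y₁ x₃ s b))) ⟩
      x₃ ∎
  sum-tangential (at _ y₁′≈) (at _ y₂′≈) (opposite _ y₁′≈-y₂′) u _ _ =
    ⊥-elim (unit⇒≉ u (trans (sym y₁′≈) (trans y₁′≈-y₂′ (-‿cong y₂′≈))))

  sum-opposite : ∀ {P Q R x y} → At x y P → At x (- y) Q → Sum P Q R → R ≈ₚ 𝒪
  sum-opposite (at x′≈ _) (at x″≈ _) (distinct _ u _) =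
    ⊥-elim (unit⇒≉ u (trans x′≈ (sym x″≈)))
  sum-opposite (at _ y′≈) (at _ y″≈) (tangential _ _ u _) =
    ⊥-elim (unit⇒≉ u (trans y′≈ (trans (sym (-‿involutive _)) (-‿cong (sym y″≈)))))
  sum-opposite _ _ (opposite _ _) = _

  private
    -- If σ is the slope of the tangent at P = (x , y) and m = 2y, the condition 3P = - 2P reads
    -- (m - σ(3x - σ²))² = (3x - σ²)²(2σ² - 3x).  Multiplied by m⁶, this is Ψ x (σm) m² = 0.
    Ψ : (x p q : Carrier) → Carrier
    Ψ x p q = G * G * (2 · (p * p) - 3 · (x * q)) - H * H
      where
      G = 3 · (x * q) - p * p
      H = q * q - p * G

    Ψ-cong : ∀ x {p p′ q q′} → p ≈ p′ → q ≈ q′ → Ψ x p q ≈ Ψ x p′ q′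
    Ψ-cong x p≈ q≈ = +-cong
      (*-cong (*-cong G≈ G≈) (+-cong (×-congʳ 2 pp≈) (-‿cong (×-congʳ 3 (*-congˡ q≈)))))
      (-‿cong (*-cong H≈ H≈))
      where
      pp≈ = *-cong p≈ p≈
      G≈ = +-cong (×-congʳ 3 (*-congˡ q≈)) (-‿cong pp≈)
      H≈ = +-cong (*-cong q≈ q≈) (-‿cong (*-cong p≈ G≈))

  -- The 5-division polynomial in X = x².
  ψ₅ : Carrier → Carrier
  ψ₅ X = 5 · (X ^ 6) + 62 · (b * X ^ 5) - 105 · (b ^ 2 * X ^ 4) - 300 · (b ^ 3 * X ^ 3)
         - 125 · (b ^ 4 * X ^ 2) - 50 · (b ^ 5 * X) + b ^ 6

  private
    -- The slopes σ, τ, ρ lead to 2P, 3P, 4P, the last two along chords. From x(4P) = x follow ρ = σ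
    -- and x(3P) = x(2P), and the chord formula for x(3P) becomes the relation behind `Ψ`.
    main-case : ∀ {x y σ τ ρ} → OnCurve x y →
      let m  = y - - y
          x₂ = thirdX σ x x
          y₂ = thirdY σ x x y
          x₃ = thirdX τ x x₂
          y₃ = thirdY τ x x₂ y
      in OnCurve x₃ y₃ →
         Unit m → σ * m ≈ 3 · (x ^ 2) + b →
         τ * (x - x₂) ≈ y - y₂ →
         Unit (x - x₃) → ρ * (x - x₃) ≈ y - y₃ →
         x ≈ thirdX ρ x x₃ →
         ψ₅ (x ^ 2) ≈ 0#
    main-case {x} {y} {σ} {τ} {ρ} on on₃ um σm≈ τ≈ u₃ ρ≈ x≈x₄ = begin
      ψ₅ (x ^ 2)
        -- By the tangent equation and the curve, p = σm = 3x² + b and q = m² = 4(x³ + bx), so `Ψ`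
        -- becomes a polynomial in x and b; it is even in x.
        ≈⟨ solve 2 (λ x b →
             let X = x :^ 2 ; p = 3 :× X :+ b ; q = 4 :× (x :^ 3 :+ b :* x)
                 G = 3 :× (x :* q) :- p :* p ; H = q :* q :- p :* G
             in 5 :× (X :^ 6) :+ 62 :× (b :* X :^ 5) :- 105 :× (b :^ 2 :* X :^ 4)
                :- 300 :× (b :^ 3 :* X :^ 3) :- 125 :× (b :^ 4 :* X :^ 2)
                :- 50 :× (b :^ 5 :* X) :+ b :^ 6
                := G :* G :* (2 :× (p :* p) :- 3 :× (x :* q)) :- H :* H)
             refl x b ⟩
      Ψ x (3 · (x ^ 2) + b) (4 · (x ^ 3 + b * x))
        ≈⟨ Ψ-cong x (sym σm≈) (×-congʳ 4 (sym on)) ⟩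
      Ψ x (σ * m) (4 · (y ^ 2))
        ≈⟨ Ψ-cong x refl (solve 1 (λ y → 4 :× (y :^ 2) := (y :- :- y) :* (y :- :- y)) refl y) ⟩
      Ψ x (σ * m) (m * m)
        ≈⟨ modulo relation (solve 3 (λ x m σ →
             let p = σ :* m ; q = m :* m
                 G = 3 :× (x :* q) :- p :* p ; H = q :* q :- p :* G
                 d = 3 :× x :- σ :* σ
             in G :* G :* (2 :× (p :* p) :- 3 :× (x :* q)) :- H :* H
                := con (+ 0) :+ m :^ 6 :* (d :* d :* (2 :× (σ :* σ) :- 3 :× x)
                                           :- (m :- σ :* d) :* (m :- σ :* d)))
             refl x m σ) ⟩
      0# ∎
      where
      m  = y - - y
      x₂ = thirdX σ x x
      y₂ = thirdY σ x x y
      x₃ = thirdX τ x x₂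
      y₃ = thirdY τ x x₂ y
      d  = 3 · x - σ * σ

      -- The line through P and 3P meets the curve in P, 3P and -4P = P, so it is the
      -- tangent at P.
      ρ-tangent : ∀ {x₃ y₃} → OnCurve x₃ y₃ → Unit (x - x₃) → ρ * (x - x₃) ≈ y - y₃ →
                  x ≈ thirdX ρ x x₃ → ρ * m ≈ 3 · (x ^ 2) + b
      ρ-tangent {x₃} {y₃} on₃ u₃ ρ≈ x≈x₄ = unit-cancel u₃
        (modulo ρ≈ (modulo on₃ (modulo on (modulo x≈x₄ (solve 6 (λ x y b ρ x₃ y₃ →
           let d = x :- x₃
           in d :* (ρ :* (y :- :- y))
              := d :* (3 :× (x :^ 2) :+ b)
                 :+ (y :- ρ :* d :+ y₃) :* (ρ :* d :- (y :- y₃))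
                 :+ (:- con (+ 1)) :* (y₃ :^ 2 :- (x₃ :^ 3 :+ b :* x₃))
                 :+ con (+ 1) :* (y :^ 2 :- (x :^ 3 :+ b :* x))
                 :+ (:- (d :* d)) :* (x :- (ρ :^ 2 :- x :- x₃)))
           refl x y b ρ x₃ y₃)))))

      ρ≈σ : ρ ≈ σ
      ρ≈σ = unit-cancel um (begin
        m * ρ           ≈⟨ *-comm m ρ ⟩
        ρ * m           ≈⟨ ρ-tangent on₃ u₃ ρ≈ x≈x₄ ⟩
        3 · (x ^ 2) + b ≈⟨ σm≈ ⟨
        σ * m           ≈⟨ *-comm σ m ⟩
        m * σ           ∎)

      x₃≈x₂ : ∀ {x₃} → x ≈ thirdX ρ x x₃ → x₃ ≈ x₂
      x₃≈x₂ {x₃} x≈x₄ = modulo ρ≈σ (modulo x≈x₄ (solve 4 (λ x ρ σ x₃ →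
        x₃ := σ :^ 2 :- x :- x :+ (ρ :+ σ) :* (ρ :- σ)
              :+ con (+ 1) :* (x :- (ρ :^ 2 :- x :- x₃))) refl x ρ σ x₃))

      relation : d * d * (2 · (σ * σ) - 3 · x) ≈ (m - σ * d) * (m - σ * d)
      -- Since x - x₂ = d and y - y₂ = m - σd, this is (τd)² = (m - σd)² with τ² = x + 2x₂ = 2σ² -
      -- 3x.
      relation = modulo (sym (x₃≈x₂ x≈x₄)) (modulo τ≈ (solve 4 (λ x y σ τ →
        let x₂ = σ :^ 2 :- x :- x
            y₂ = σ :* (x :- x₂) :- y
            m = y :- :- y ; d = 3 :× x :- σ :* σ
        in d :* d :* (2 :× (σ :* σ) :- 3 :× x)
           := (m :- σ :* d) :* (m :- σ :* d)
              :+ d :* d :* (x₂ :- (τ :^ 2 :- x :- x₂))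
              :+ (τ :* d :+ (y :- y₂)) :* (τ :* (x :- x₂) :- (y :- y₂)))
        refl x y σ τ))

    -- Here 3P = P, so 4P = 2P.
    degenerate-case : ∀ {x y σ x₃ y₃ ρ} → OnCurve x y → OnCurve x₃ y₃ →
      σ * (y - - y) ≈ 3 · (x ^ 2) + b →
      x ≈ x₃ → Unit (y - - y₃) → ρ * (y - - y₃) ≈ 3 · (x ^ 2) + b →
      thirdX ρ x x₃ ≈ x → x ≈ thirdX σ x x
    degenerate-case {x} {y} {σ} {x₃} {y₃} {ρ} on on₃ σm≈ x≈x₃ u ρ≈ x₄≈x =
      modulo x₄≈x (modulo ρ≈σ (modulo x≈x₃ (solve 4 (λ x σ x₃ ρ →
        x := σ :^ 2 :- x :- x :+ (:- con (+ 1)) :* (ρ :^ 2 :- x :- x₃ :- x)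
             :+ (ρ :+ σ) :* (ρ :- σ) :+ con (+ 1) :* (x :- x₃)) refl x σ x₃ ρ)))
      where
      y≈y₃ : y ≈ y₃
      y≈y₃ = unit-cancel u (modulo on (modulo on₃ (modulo x≈x₃ (solve 5 (λ x y x₃ y₃ b →
        (y :- :- y₃) :* y
        := (y :- :- y₃) :* y₃ :+ con (+ 1) :* (y :^ 2 :- (x :^ 3 :+ b :* x))
           :+ (:- con (+ 1)) :* (y₃ :^ 2 :- (x₃ :^ 3 :+ b :* x₃))
           :+ (x :^ 2 :+ x :* x₃ :+ x₃ :^ 2 :+ b) :* (x :- x₃)) refl x y x₃ y₃ b))))
      ρ≈σ : ρ ≈ σ
      ρ≈σ = unit-cancel u (begin
        (y - - y₃) * ρ   ≈⟨ *-comm _ ρ ⟩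
        ρ * (y - - y₃)   ≈⟨ ρ≈ ⟩
        3 · (x ^ 2) + b  ≈⟨ σm≈ ⟨
        σ * (y - - y)    ≈⟨ *-congˡ (+-congˡ (-‿cong (-‿cong y≈y₃))) ⟩
        σ * (y - - y₃)   ≈⟨ *-comm σ _ ⟩
        (y - - y₃) * σ   ∎)

  sum-𝒪 : ∀ {x y on Q R} → Sum (affine x y on) Q R → R ≈ₚ 𝒪 → At x (- y) Q
  sum-𝒪 (opposite x≈x′ y≈-y′) _ =
    at (sym x≈x′) (trans (sym (-‿involutive _)) (-‿cong (sym y≈-y′)))

  -- The hypotheses say 4P = - P. Only the sequence tangent, chord, chord survives; the other cases,
  -- where 2P = 𝒪, 3P = 𝒪, 3P = P or x(2P) = x, make an inverted denominator vanish.
  five-torsion-sums : ∀ {x y on Q₂ Q₃ Q₄} → let P = affine x y on in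
                      Sum P P Q₂ → Sum P Q₂ Q₃ → Sum P Q₃ Q₄ → At x (- y) Q₄ →
                      ψ₅ (x ^ 2) ≈ 0#
  five-torsion-sums (distinct _ u _) _ _ _ = ⊥-elim (unit⇒≉ u refl)
  five-torsion-sums {on = on} (tangential σ _ um σm≈) (distinct τ {on₃} _ τ≈) (distinct ρ u₃ ρ≈)
                    (at x₄≈x _) = main-case on on₃ um σm≈ τ≈ u₃ ρ≈ (sym x₄≈x)
  five-torsion-sums {on = on} (tangential σ _ um σm≈) (distinct τ {on₃} u₂ τ≈)
                    (tangential ρ x≈x₃ u ρ≈) (at x₄≈x _) =
    ⊥-elim (unit⇒≉ u₂ (degenerate-case on on₃ σm≈ x≈x₃ u ρ≈ x₄≈x))
  five-torsion-sums {x} {y} (tangential σ _ um σm≈) (tangential τ x≈x₂ u τ≈) _ _ =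
    ⊥-elim (unit⇒≉ u (modulo x≈x₂ (solve 3 (λ x y σ →
      let x₂ = σ :^ 2 :- x :- x
      in y := :- (σ :* (x :- x₂) :- y) :+ σ :* (x :- x₂)) refl x y σ)))
  five-torsion-sums (tangential σ _ um σm≈) (opposite _ _) 𝒪ʳ (at _ y≈-y) =
    ⊥-elim (unit⇒≉ um y≈-y)
  five-torsion-sums (opposite _ _) 𝒪ʳ (distinct _ u _) _ = ⊥-elim (unit⇒≉ u refl)
  five-torsion-sums (opposite _ y≈-y) 𝒪ʳ (tangential _ _ u _) _ = ⊥-elim (unit⇒≉ u y≈-y)

  five-torsion-root : ∀ {x y} on → IsTorsion 5 (affine x y on) → ψ₅ (x ^ 2) ≈ 0#
  five-torsion-root {x} {y} on 5P≈𝒪 =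
    -- The innermost term of `5 ×ₚ P` is `P ⊕ 𝒪`, which computes to `P`.
    five-torsion-sums (⊕-Sum P P) (⊕-Sum P _) (⊕-Sum P _) (sum-𝒪 (⊕-Sum P _) 5P≈𝒪)
    where P = affine x y on

-- The coordinates of the 5-torsion points

module FactorCoordinates (L : Field c ℓ ℓ′) where
  open Field L
  open Units L
  open QuadraticLift L using (modulo)
  open IntegerCoefficientSolver L
  open SetoidReasoning setoid

  module _ {b n u h k θ θ+1 s w i x y : Carrier}
           (h²u≈nθ : h * h * u ≈ n * θ) (k²[u+n]≈nh[θ+1] : k * k * (u + n) ≈ n * h * θ+1)
           (s²≈ : s * s ≈ θ * b) (w²≈ : w * w ≈ θ+1 * b * s) (i²+1≈0 : i ^ 2 + fromℤ (+ 1) ≈ 0#)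
           (on : y ^ 2 ≈ x ^ 3 + b * x) (root : n * x ^ 2 - u * b ≈ 0#)
           (unit-n : Unit n) (unit-h : Unit h) where

    private
      nx²≈ub : n * x ^ 2 ≈ u * b
      nx²≈ub = x-y≈0⇒x≈y root

    hx≈±s : h * x ≈ s ⊎ h * x ≈ - s
    hx≈±s = square-roots (unit-cancel unit-n (begin
      n * (h * x * (h * x))  ≈⟨ solve 3 (λ n h x → n :* (h :* x :* (h :* x)) := h :* h :* (n :* x :^ 2))
                                  refl n h x ⟩
      h * h * (n * x ^ 2)    ≈⟨ *-congˡ nx²≈ub ⟩
      h * h * (u * b)        ≈⟨ *-assoc (h * h) u b ⟨
      h * h * u * b          ≈⟨ *-congʳ h²u≈nθ ⟩
      n * θ * b              ≈⟨ *-assoc n θ b ⟩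
      n * (θ * b)            ≈⟨ *-congˡ s²≈ ⟨
      n * (s * s)            ∎))

    ky-square : ∀ {e} → h * x ≈ e → k * y * (k * y) ≈ θ+1 * b * e
    ky-square {e} hx≈e = unit-cancel (unit-* unit-n unit-h) (begin
      n * h * (k * y * (k * y))
        ≈⟨ solve 4 (λ n h k y → n :* h :* (k :* y :* (k :* y)) := k :* k :* (n :* h :* y :^ 2))
             refl n h k y ⟩
      k * k * (n * h * y ^ 2)
        ≈⟨ *-congˡ (*-congˡ on) ⟩
      k * k * (n * h * (x ^ 3 + b * x))
        ≈⟨ *-congˡ (solve 4 (λ n h b x →
             n :* h :* (x :^ 3 :+ b :* x) := h :* x :* (n :* x :^ 2 :+ n :* b)) refl n h b x) ⟩
      k * k * (h * x * (n * x ^ 2 + n * b))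
        ≈⟨ *-congˡ (*-cong hx≈e (+-congʳ nx²≈ub)) ⟩
      k * k * (e * (u * b + n * b))
        ≈⟨ solve 5 (λ k² e u n b → k² :* (e :* (u :* b :+ n :* b)) := k² :* (u :+ n) :* (b :* e))
             refl (k * k) e u n b ⟩
      k * k * (u + n) * (b * e)
        ≈⟨ *-congʳ k²[u+n]≈nh[θ+1] ⟩
      n * h * θ+1 * (b * e)
        ≈⟨ solve 4 (λ nh t b e → nh :* t :* (b :* e) := nh :* (t :* b :* e))
             refl (n * h) θ+1 b e ⟩
      n * h * (θ+1 * b * e) ∎)

    -- If hx = - s, then (ky)² = - w² = (iw)²; this is where the values ± iw come from.
    ky≈ : (k * y ≈ w ⊎ k * y ≈ - w) ⊎ (k * y ≈ i * w ⊎ k * y ≈ - (i * w))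
    ky≈ = map (λ hx≈s  → square-roots (trans (ky-square hx≈s) (sym w²≈)))
              (λ hx≈-s → square-roots (trans (ky-square hx≈-s) rotated)) hx≈±s
      where
      rotated : θ+1 * b * - s ≈ i * w * (i * w)
      rotated = begin
        θ+1 * b * - s       ≈⟨ solve 2 (λ r s → r :* (:- s) := :- (r :* s)) refl (θ+1 * b) s ⟩
        - (θ+1 * b * s)     ≈⟨ -‿cong w²≈ ⟨
        - (w * w)           ≈⟨ modulo i²+1≈0 (solve 2 (λ w i →
                                 i :* w :* (i :* w)
                                 := :- (w :* w) :+ w :* w :* (i :^ 2 :+ con (+ 1) :- con (+ 0)))
                                 refl w i) ⟨
        i * w * (i * w)     ∎

-- Specialising ℤ[i, ζ] to L and splitting the division polynomial

module Coordinates (L : Field c ℓ ℓ′) (b i ζ : Field.Carrier L) where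
  open Field L
  open Units L
  open QuadraticLift L
  open AdditionLaw L b using
    (At; at; ⊕-Sum; sum-distinct; sum-tangential; sum-opposite; ψ₅; five-torsion-root)
  open Curve L b
  open SetoidReasoning setoid
  private
    module C = Cyclotomic
    module ℤ-Solver = IntegerCoefficientSolver L
  open ℤ-Solver using (fromℤ; almostCommutativeRing; morphism)

  Φ₅ : Carrier
  Φ₅ = ζ ^ 4 + ζ ^ 3 + ζ ^ 2 + ζ + fromℤ (+ 1)

  -- `ζ ^ 4` is ζ⁻¹ in polynomial form.
  η : Carrier
  η = ζ + ζ ^ 4

  -- `κ` interprets the integer coefficients: as multiples of `1#` for the solver over ℤ, or as
  -- images of elements of ℤ[i, ζ] for the cyclotomic one.
  quartic quadraticForm : (κ : ℕ → Carrier) → Carrier → Carrier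
  quartic        κ X = X ^ 4 + κ 12 * (b * X ^ 3) - κ 26 * (b ^ 2 * X ^ 2)
                       - κ 52 * (b ^ 3 * X) + b ^ 4
  quadraticForm κ X = κ 5 * X ^ 2 + κ 2 * (b * X) + b ^ 2

  -- A factorisation over ℤ: the roots of the quadratic form come from the points killed by 2 + i or
  -- 2 - i, those of the quartic from the other points of order 5.
  ψ₅-product : ∀ X → quartic (_· 1#) X * quadraticForm (_· 1#) X ≈ ψ₅ X
  ψ₅-product X = solve 2 (λ X b →
    (X :^ 4 :+ con (+ 12) :* (b :* X :^ 3) :- con (+ 26) :* (b :^ 2 :* X :^ 2)
      :- con (+ 52) :* (b :^ 3 :* X) :+ b :^ 4)
    :* (con (+ 5) :* X :^ 2 :+ con (+ 2) :* (b :* X) :+ b :^ 2)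
    := 5 :× (X :^ 6) :+ 62 :× (b :* X :^ 5) :- 105 :× (b :^ 2 :* X :^ 4)
       :- 300 :× (b :^ 3 :* X :^ 3) :- 125 :× (b :^ 4 :* X :^ 2)
       :- 50 :× (b :^ 5 :* X) :+ b :^ 6) refl X b
    where open ℤ-Solver

  module WithRoots (unit-b : Unit b) (natural-unit : ∀ n → Unit (suc n · 1#))
                   (i²+1≈0 : i ^ 2 + fromℤ (+ 1) ≈ 0#) (Φ₅≈0 : Φ₅ ≈ 0#) where

    ℤ[i]⟶ : ℤ[i] ⟶L
    ℤ[i]⟶ = lift morphism (+ 0) -[1+ 0 ] (modulo i²+1≈0 (solve 1 (λ i →
      i :* i := con (+ 0) :* i :+ con -[1+ 0 ] :+ con (+ 1) :* (i :^ 2 :+ con (+ 1) :- con (+ 0)))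
      refl i))
      where open ℤ-Solver

    ℤ[i,η]⟶ : ℤ[i,η] ⟶L
    ℤ[i,η]⟶ = lift ℤ[i]⟶ (C.ℤi.- C.ℤi.1#) C.ℤi.1# {η} (modulo Φ₅≈0 (solve 2 (λ i ζ →
      let η = ζ :+ ζ :^ 4 in
      η :* η := (con -[1+ 0 ] :+ con (+ 0) :* i) :* η :+ (con (+ 1) :+ con (+ 0) :* i)
                -- The quotient of η² + η - 1 by Φ₅, as polynomials in ζ.
                :+ (ζ :^ 4 :- ζ :^ 3 :+ con (+ 2) :* ζ :- con (+ 1))
                   :* (ζ :^ 4 :+ ζ :^ 3 :+ ζ :^ 2 :+ ζ :+ con (+ 1) :- con (+ 0))) refl i ζ))
      where open ℤ-Solver

    ℤ[i,ζ]⟶ : ℤ[i,ζ] ⟶L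
    ℤ[i,ζ]⟶ = lift ℤ[i,η]⟶ (C.ℤi.0# , C.ℤi.1#) (C.ℤi.- C.ℤi.1# , C.ℤi.- C.ℤi.0#) {ζ} (modulo Φ₅≈0 (solve 2 (λ i ζ →
      let η = ζ :+ ζ :^ 4
          zero = con (+ 0) :+ con (+ 0) :* i
      in
      ζ :* ζ := (zero :+ (con (+ 1) :+ con (+ 0) :* i) :* η) :* ζ
                :+ (con -[1+ 0 ] :+ con (+ 0) :* i :+ zero :* η)
                :+ (con (+ 1) :- ζ)
                   :* (ζ :^ 4 :+ ζ :^ 3 :+ ζ :^ 2 :+ ζ :+ con (+ 1) :- con (+ 0))) refl i ζ))
      where open ℤ-Solver

    private
      module φ = ACR._-Raw-AlmostCommutative⟶_ ℤ[i,ζ]⟶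
    open φ public using (⟦_⟧)

    ⟦gaussian⟧ : ∀ x → ⟦ C.gaussian x ⟧ ≈ value morphism i x
    ⟦gaussian⟧ x = trans (value-const ℤ[i,η]⟶ ζ (x , C.ℤi.0#)) (value-const ℤ[i]⟶ η x)

    ⟦ζ⟧≈ζ : ⟦ C.ζ ⟧ ≈ ζ
    ⟦ζ⟧≈ζ = value-root ℤ[i,η]⟶ ζ

    ⟦natural⟧ : ∀ n → ⟦ C.integer (+ n) ⟧ ≈ n · 1#
    ⟦natural⟧ n = trans (⟦gaussian⟧ (+ n , + 0)) (value-const morphism i (+ n))

    θ₁≈⟦θ⟧ : θ₁ L i ζ ≈ ⟦ C.θ ⟧
    θ₁≈⟦θ⟧ = modulo Φ₅≈0 (solve 2 (λ i ζ →
      let η = ζ :+ ζ :^ 4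
          -- The three maps write `⟦_⟧` out as a polynomial in i and ζ, which the solver over ℤ can
          -- compare with `θ₁`.
          embed₀ = λ (x , y) → con x :+ con y :* i
          embed₁ = λ (x , y) → embed₀ x :+ embed₀ y :* η
          embed₂ = λ (x , y) → embed₁ x :+ embed₁ y :* ζ
      in
      :- ((:- (4 :× i) :+ con (+ 4)) :* ζ :^ 3 :+ 4 :× (ζ :^ 2) :- 4 :× (i :* ζ) :- 2 :× i :+ con (+ 5))
      := embed₂ C.θ
         :+ ((4 :× i :- con (+ 4)) :* ζ :+ con (+ 4) :* (ζ :- con (+ 1)))
            :* (ζ :^ 4 :+ ζ :^ 3 :+ ζ :^ 2 :+ ζ :+ con (+ 1) :- con (+ 0))) refl i ζ)
      where open ℤ-Solver

    -- Invertibility is certified by a cofactor `y` in ℤ[i, ζ]. The integer reached is 1 for `θ`, 2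
    -- for `θ+1` and `1-f`, and 5 for the leading coefficients of the factors.
    ⟦⟧-unit : ∀ x y {n} → x C.* y ≡ C.integer (+ suc n) → Unit ⟦ x ⟧
    ⟦⟧-unit x y {n} xy≡n = unit-factorˡ ⟦ x ⟧ (unit-resp (begin
      suc n · 1#                   ≈⟨ ⟦natural⟧ (suc n) ⟨
      ⟦ C.integer (+ suc n) ⟧      ≡⟨ ≡.cong ⟦_⟧ xy≡n ⟨
      ⟦ x C.* y ⟧                  ≈⟨ φ.*-homo x y ⟩
      ⟦ x ⟧ * ⟦ y ⟧                ∎) (natural-unit n))

    unit-θ : Unit ⟦ C.θ ⟧
    unit-θ = ⟦⟧-unit C.θ C.θ⁻¹ ≡.refl

    unit-θ+1 : Unit ⟦ C.θ+1 ⟧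
    unit-θ+1 = ⟦⟧-unit C.θ+1 C.2/⟨θ+1⟩ ≡.refl

    -- Equality of constants is decided on their integer coordinates, so the solver can take θ, f
    -- and g as coefficients.
    _coeff≟_ : (x y : C.Carrier) → Maybe (⟦ x ⟧ ≈ ⟦ y ⟧)
    x coeff≟ y with x C.≟ y
    ... | yes ≡.refl = just refl
    ... | no _       = nothing

    open RingSolver ℤ[i,ζ] almostCommutativeRing ℤ[i,ζ]⟶ _coeff≟_
      using (Polynomial; solve; _:=_; _:+_; _:*_; _:-_; :-_; _:^_; con)

    -- General in s and w, since it serves both for (s , w) and for (- s , iw).
    module WithTorsionPoint (s w : Carrier) (s²≈ : s * s ≈ ⟦ C.θ ⟧ * b)
                            (w²≈ : w * w ≈ ⟦ C.θ+1 ⟧ * b * s) where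

      unit-s : Unit s
      unit-s = unit-root s s²≈ (unit-* unit-θ unit-b)

      unit-w : Unit w
      unit-w = unit-root w w²≈ (unit-* (unit-* unit-θ+1 unit-b) unit-s)

      unit-2w : Unit (w - - w)
      unit-2w = unit-double (natural-unit 1) unit-w

      unit-s-fs : Unit (s - ⟦ C.f ⟧ * s)
      unit-s-fs = unit-resp (solve 1 (λ s → con C.1-f :* s := s :- con C.f :* s) refl s)
        (unit-* (⟦⟧-unit C.1-f C.2/⟨1-f⟩ ≡.refl) unit-s)

      on : OnCurve s w
      on = modulo w²≈ (modulo s²≈ (solve 3 (λ s w b →
        w :^ 2 := s :^ 3 :+ b :* s :+ con C.1# :* (w :* w :- con C.θ+1 :* b :* s)
                  :+ (:- s) :* (s :* s :- con C.θ :* b)) refl s w b))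

      -- Once w² is replaced by (θ + 1)bs and s² by θb, each abscissa condition, and the ordinate
      -- condition of the doubling, reduces to a constant of ℤ[i, ζ] times b² or bs. The constant is
      -- zero by computation.
      five-torsion : IsTorsion 5 (affine s w on)
      five-torsion = sum-opposite at-P at-4P (⊕-Sum P _)
        where
        P = affine s w on
        at-P : At s w P
        at-P = at refl refl
        at-2P : At (⟦ C.f ⟧ * s) (⟦ C.g ⟧ * w) (P ⊕ P)
        at-2P = sum-tangential at-P at-P (⊕-Sum P P) unit-2w
          (modulo w²≈ (modulo s²≈ (solve 3 (λ s w b →
            let e = s :* s :+ s :* s :+ s :* s :+ b ; d = w :- :- w
                t = con C.θ :* b ; r = con C.θ+1 :* b ; f = con C.f
            in e :* e := d :* d :* (s :+ s :+ f :* s)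
               :+ (:- (con (C.integer (+ 4)) :* ((con C.1# :+ con C.1# :+ f) :* s))) :* (w :* w :- r :* s)
               :+ (:- (con (C.integer (+ 4)) :* ((con C.1# :+ con C.1# :+ f) :* r)) :+ con (C.integer (+ 9)) :* (s :* s :+ t) :+ con (C.integer (+ 6)) :* b)
                  :* (s :* s :- t)) refl s w b)))
          (modulo w²≈ (modulo s²≈ (solve 3 (λ s w b →
            let e = s :* s :+ s :* s :+ s :* s :+ b ; d = w :- :- w
                t = con C.θ :* b ; r = con C.θ+1 :* b ; f = con C.f ; g = con C.g
            in e :* (s :- f :* s) := d :* (w :+ g :* w)
               :+ (:- (con (C.integer (+ 2)) :* (con C.1# :+ g))) :* (w :* w :- r :* s)
               :+ con (C.integer (+ 3)) :* con C.1-f :* s :* (s :* s :- t)) refl s w b)))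
        at-3P : At (⟦ C.f ⟧ * s) (- (⟦ C.g ⟧ * w)) (P ⊕ (P ⊕ P))
        at-3P = sum-distinct at-P at-2P (⊕-Sum P _) unit-s-fs
          (modulo w²≈ (modulo s²≈ (solve 3 (λ s w b →
            let d = s :- con C.f :* s ; e = w :- con C.g :* w
                t = con C.θ :* b ; r = con C.θ+1 :* b ; f = con C.f ; g = con C.g
            in e :* e := d :* d :* (s :+ f :* s :+ f :* s)
               :+ (con C.1# :- g) :^ 2 :* (w :* w :- r :* s)
               :+ (:- ((con C.1# :- f) :^ 2 :* (con C.1# :+ f :+ f) :* s)) :* (s :* s :- t))
            refl s w b)))
          -- As 3P = - 2P, both sides of the ordinate condition are the same product.
          (solve 2 (λ s w →
            (w :- con C.g :* w) :* (s :- con C.f :* s)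
            := (s :- con C.f :* s) :* (w :+ :- (con C.g :* w))) refl s w)
        at-4P : At s (- w) (P ⊕ (P ⊕ (P ⊕ P)))
        at-4P = sum-distinct at-P at-3P (⊕-Sum P _) unit-s-fs
          (modulo w²≈ (modulo s²≈ (solve 3 (λ s w b →
            let d = s :- con C.f :* s ; e = w :- :- (con C.g :* w)
                t = con C.θ :* b ; r = con C.θ+1 :* b ; f = con C.f ; g = con C.g
            in e :* e := d :* d :* (s :+ f :* s :+ s)
               :+ (con C.1# :+ g) :^ 2 :* (w :* w :- r :* s)
               :+ (:- ((con C.1# :- f) :^ 2 :* (con C.1# :+ con C.1# :+ f) :* s)) :* (s :* s :- t))
            refl s w b)))
          (solve 2 (λ s w →
            (w :- :- (con C.g :* w)) :* (s :- s)
            := (s :- con C.f :* s) :* (w :+ :- w)) refl s w)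

    open C.Factor

    linear : Carrier → C.Factor → Carrier
    linear X F = ⟦ n F ⟧ * X - ⟦ u F ⟧ * b

    quartic-factors : ∀ X →
      linear X C.F₁ * linear X C.F₂ * (linear X C.F₃ * linear X C.F₄) ≈
      quartic (λ m → ⟦ C.integer (+ m) ⟧) X
    quartic-factors X = solve 2 (λ X b →
      let l = λ F → con (n F) :* X :- con (u F) :* b
          κ : ℕ → Polynomial 2
          κ = λ m → con (C.integer (+ m))
      in l C.F₁ :* l C.F₂ :* (l C.F₃ :* l C.F₄)
         := X :^ 4 :+ κ 12 :* (b :* X :^ 3) :- κ 26 :* (b :^ 2 :* X :^ 2)
            :- κ 52 :* (b :^ 3 :* X) :+ b :^ 4) refl X b

    quadratic-factors : ∀ X → linear X C.F₅ * (linear X C.F₆ * ⟦ C.1# ⟧) ≈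
                        quadraticForm (λ m → ⟦ C.integer (+ m) ⟧) X
    quadratic-factors X = solve 2 (λ X b →
      let l = λ F → con (n F) :* X :- con (u F) :* b
          κ : ℕ → Polynomial 2
          κ = λ m → con (C.integer (+ m))
      in l C.F₅ :* (l C.F₆ :* con C.1#) := κ 5 :* X :^ 2 :+ κ 2 :* (b :* X) :+ b :^ 2) refl X b

    ψ₅-factors : ∀ X → foldr (λ F → linear X F *_) ⟦ C.1# ⟧ C.factors ≈ ψ₅ X
    ψ₅-factors X = begin
      l C.F₁ * (l C.F₂ * (l C.F₃ * (l C.F₄ * (l C.F₅ * (l C.F₆ * ⟦ C.1# ⟧)))))
        ≈⟨ regroup (l C.F₁) (l C.F₂) (l C.F₃) (l C.F₄) _ ⟩
      l C.F₁ * l C.F₂ * (l C.F₃ * l C.F₄) * (l C.F₅ * (l C.F₆ * ⟦ C.1# ⟧))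
        ≈⟨ *-cong (quartic-factors X) (quadratic-factors X) ⟩
      quartic (λ m → ⟦ C.integer (+ m) ⟧) X * quadraticForm (λ m → ⟦ C.integer (+ m) ⟧) X
        -- Passes from the cyclotomic coefficients to the multiples of `1#` used in `ψ₅-product`.
        ≈⟨ *-cong
             (+-congʳ (+-cong (+-cong (+-congˡ (κ≈ 12)) (-‿cong (κ≈ 26))) (-‿cong (κ≈ 52))))
             (+-congʳ (+-cong (κ≈ 5) (κ≈ 2))) ⟩
      quartic (_· 1#) X * quadraticForm (_· 1#) X
        ≈⟨ ψ₅-product X ⟩
      ψ₅ X ∎
      where
      l = linear X
      κ≈ : ∀ m {x} → ⟦ C.integer (+ m) ⟧ * x ≈ m · 1# * x
      κ≈ m = *-congʳ (⟦natural⟧ m)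
      regroup : ∀ p q r s t → p * (q * (r * (s * t))) ≈ p * q * (r * s) * t
      regroup = solve 5 (λ p q r s t → p :* (q :* (r :* (s :* t))) := p :* q :* (r :* s) :* t) refl

    64ζ : ⟦ C.integer (+ 64) ⟧ * ⟦ C.ζ ⟧ ≈
          ⟦ C.gaussian C.a₀ ⟧ + ⟦ C.gaussian C.a₁ ⟧ * ⟦ C.θ ⟧
            + ⟦ C.gaussian C.a₂ ⟧ * (⟦ C.θ ⟧ * ⟦ C.θ ⟧)
            + ⟦ C.gaussian C.a₃ ⟧ * (⟦ C.θ ⟧ * (⟦ C.θ ⟧ * ⟦ C.θ ⟧))
    64ζ = solve 0 (con (C.integer (+ 64)) :* con C.ζ :=
      con (C.gaussian C.a₀) :+ con (C.gaussian C.a₁) :* con C.θ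
      :+ con (C.gaussian C.a₂) :* (con C.θ :* con C.θ)
      :+ con (C.gaussian C.a₃) :* (con C.θ :* (con C.θ :* con C.θ))) refl

    triple-homo : ∀ x y z → ⟦ x C.* y C.* z ⟧ ≈ ⟦ x ⟧ * ⟦ y ⟧ * ⟦ z ⟧
    triple-homo x y z = trans (φ.*-homo (x C.* y) z) (*-congʳ (φ.*-homo x y))

    module CompatibleEquations {F} (compatible : C.IsCompatible F) where
      open C.IsCompatible compatible

      unit-n : Unit ⟦ n F ⟧
      unit-n = ⟦⟧-unit (n F) (n̄ F) nn̄≡5

      h²u≈nθ : ⟦ h F ⟧ * ⟦ h F ⟧ * ⟦ u F ⟧ ≈ ⟦ n F ⟧ * ⟦ C.θ ⟧
      h²u≈nθ = begin
        ⟦ h F ⟧ * ⟦ h F ⟧ * ⟦ u F ⟧   ≈⟨ triple-homo (h F) (h F) (u F) ⟨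
        ⟦ h F C.* h F C.* u F ⟧       ≡⟨ ≡.cong ⟦_⟧ h²u≡nθ ⟩
        ⟦ n F C.* C.θ ⟧               ≈⟨ φ.*-homo (n F) C.θ ⟩
        ⟦ n F ⟧ * ⟦ C.θ ⟧             ∎

      k²[u+n]≈nhθ+1 : ⟦ k F ⟧ * ⟦ k F ⟧ * (⟦ u F ⟧ + ⟦ n F ⟧) ≈ ⟦ n F ⟧ * ⟦ h F ⟧ * ⟦ C.θ+1 ⟧
      k²[u+n]≈nhθ+1 = begin
        ⟦ k F ⟧ * ⟦ k F ⟧ * (⟦ u F ⟧ + ⟦ n F ⟧)  ≈⟨ *-congˡ (φ.+-homo (u F) (n F)) ⟨
        ⟦ k F ⟧ * ⟦ k F ⟧ * ⟦ u F C.+ n F ⟧      ≈⟨ triple-homo (k F) (k F) (u F C.+ n F) ⟨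
        ⟦ k F C.* k F C.* (u F C.+ n F) ⟧        ≡⟨ ≡.cong ⟦_⟧ k²[u+n]≡nhθ+1 ⟩
        ⟦ n F C.* h F C.* C.θ+1 ⟧                ≈⟨ triple-homo (n F) (h F) C.θ+1 ⟩
        ⟦ n F ⟧ * ⟦ h F ⟧ * ⟦ C.θ+1 ⟧            ∎

      unit-h : Unit ⟦ h F ⟧
      unit-h = unit-square-factor ⟦ h F ⟧ h²u≈nθ (unit-* unit-n unit-θ)

      unit-k : Unit ⟦ k F ⟧
      unit-k = unit-square-factor ⟦ k F ⟧ k²[u+n]≈nhθ+1 (unit-* (unit-* unit-n unit-h) unit-θ+1)

    θ₁+1≈⟦θ+1⟧ : θ₁ L i ζ + 1# ≈ ⟦ C.θ+1 ⟧
    θ₁+1≈⟦θ+1⟧ = trans (+-cong θ₁≈⟦θ⟧ (sym φ.1-homo)) (sym (φ.+-homo C.θ C.1#))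

    -- Says that x and y arise from ± s, ± w, ± iw on division by constants of ℤ[i, ζ], hence lie in
    -- any field containing ζ, i, s and w.
    CoordinatesFrom : (s w x y : Carrier) → Set (c ⊔ ℓ)
    CoordinatesFrom s w x y = ∃[ h ] ∃[ k ] Unit ⟦ h ⟧ × Unit ⟦ k ⟧
      × (⟦ h ⟧ * x ≈ s ⊎ ⟦ h ⟧ * x ≈ - s)
      × ((⟦ k ⟧ * y ≈ w ⊎ ⟦ k ⟧ * y ≈ - w) ⊎ (⟦ k ⟧ * y ≈ i * w ⊎ ⟦ k ⟧ * y ≈ - (i * w)))

    factor-coordinates : ∀ {s w x y} → s * s ≈ ⟦ C.θ ⟧ * b → w * w ≈ ⟦ C.θ+1 ⟧ * b * s →
      OnCurve x y → ∀ F → C.IsCompatible F → linear (x ^ 2) F ≈ 0# → CoordinatesFrom s w x y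
    factor-coordinates s²≈ w²≈ on F compatible root =
      h F , k F , unit-h , unit-k
      , hx≈±s h²u≈nθ k²[u+n]≈nhθ+1 s²≈ w²≈ i²+1≈0 on root unit-n unit-h
      , ky≈ h²u≈nθ k²[u+n]≈nhθ+1 s²≈ w²≈ i²+1≈0 on root unit-n unit-h
      where
      open FactorCoordinates L
      open CompatibleEquations compatible

    vanishing-factor : ∀ {X} → ψ₅ X ≈ 0# → ∃[ F ] C.IsCompatible F × linear X F ≈ 0#
    vanishing-factor {X} ψ₅≈0 = Any.lookup some , All.lookupAny C.factors-compatible some
      where
      some : Any (λ F → linear X F ≈ 0#) C.factors
      some = product-zero {e = ⟦ C.1# ⟧} (linear X) C.factors
        (λ ⟦1⟧≈0 → 1≉0 (trans (sym φ.1-homo) ⟦1⟧≈0)) (trans (ψ₅-factors X) ψ₅≈0)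

    torsion-coordinates : ∀ {s w x y} → s * s ≈ ⟦ C.θ ⟧ * b → w * w ≈ ⟦ C.θ+1 ⟧ * b * s →
      (on : OnCurve x y) → IsTorsion 5 (affine x y on) → CoordinatesFrom s w x y
    torsion-coordinates s²≈ w²≈ on 5P≈𝒪 =
      let F , compatible , root = vanishing-factor (five-torsion-root on 5P≈𝒪)
      in factor-coordinates s²≈ w²≈ on F compatible root

-- Comparison of the two fields

module _ {F : Field c₁ ℓ₁ ℓ₁′} {L : Field c₂ ℓ₂ ℓ₂′} {E : Extension F L} {S : Pred (Field.Carrier L) p}
  where
  open Field L
  open QuadraticLift L using (_⟶L; value)

  value∈ : ∀ {R} (φ : R ⟶L) {t} → (∀ x → Adjoin E S (ACR._-Raw-AlmostCommutative⟶_.⟦_⟧ φ x)) →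
           Adjoin E S t → ∀ x → Adjoin E S (value φ t x)
  value∈ φ coefficients∈ t∈ (x , y) = add (coefficients∈ x) (mul (coefficients∈ y) t∈)

-- Sums of ones are positive in the ordered field ℚ. Carried along ℚ → K → K̄, this is
-- characteristic zero.
ℚ-natural-unit : ∀ n → Units.Unit ℚ-field (Field._·_ ℚ-field (suc n) 1ℚ)
ℚ-natural-unit n = Units.≉0⇒unit ℚ-field (λ eq → ℚ.<-irrefl (≡.sym eq) (positive n))
  where
  open Field ℚ-field using (_·_)
  nonnegative : ∀ n → 0ℚ ℚ.≤ n · 1ℚ
  nonnegative zero    = ℚ.≤-refl
  nonnegative (suc n) = ℚ.+-mono-≤ (ℚ.nonNegative⁻¹ 1ℚ) (nonnegative n)
  positive : ∀ n → 0ℚ ℚ.< suc n · 1ℚ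
  positive n = ℚ.+-mono-<-≤ (ℚ.positive⁻¹ 1ℚ) (nonnegative n)

module _ (L : Field c ℓ ℓ′) where
  open Field L
  open Units L
  open IntegerCoefficientSolver L

  -- ζ⁵ - 1 = (ζ - 1)Φ₅, and primitivity at the exponent 1 excludes ζ = 1.
  Φ₅-root : ∀ {ζ} → IsPrimitiveRoot 5 ζ → Coordinates.Φ₅ L 0# 0# ζ ≈ 0#
  Φ₅-root {ζ} (ζ⁵≈1 , minimal) = [ ⊥-elim ∘ ζ-1≉0 , (λ Φ₅≈0 → Φ₅≈0) ] (zero-product
    (QuadraticLift.modulo L (trans ζ⁵≈1 (sym (+-identityʳ 1#))) (solve 1 (λ ζ →
      (ζ :- con (+ 1)) :* (ζ :^ 4 :+ ζ :^ 3 :+ ζ :^ 2 :+ ζ :+ con (+ 1))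
      := con (+ 0) :+ con (+ 1) :* (ζ :^ 5 :- con (+ 1))) refl ζ)))
    where
    ζ-1≉0 : ζ - fromℤ (+ 1) ≉ 0#
    ζ-1≉0 eq = minimal 1 (s≤s z≤n) (s≤s (s≤s z≤n))
      (trans (*-identityʳ ζ) (trans (x-y≈0⇒x≈y eq) (+-identityʳ 1#)))

module Generators {K : Field c₁ ℓ₁ ℓ₁′} {K̄ : Field c₂ ℓ₂ ℓ₂′} (E : Extension K K̄)
                  (b : Field.Carrier K) (i ζ s w : Field.Carrier K̄) where
  open Field K̄
  open Extension E
  open Units K̄
  open IntegerCoefficientSolver K̄ using (fromℤ; morphism)
  open QuadraticLift K̄ using (value)
  open Curve K̄ (embed b)
  open Coordinates K̄ (embed b) i ζ
  private
    module C = Cyclotomic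

  module Relations (unit-b : Unit (embed b)) (natural-unit : ∀ n → Unit (suc n · 1#))
                    (i²+1≈0 : i ^ 2 + fromℤ (+ 1) ≈ 0#) (Φ₅≈0 : Φ₅ ≈ 0#) where
    open WithRoots unit-b natural-unit i²+1≈0 Φ₅≈0

    module _ (s²≈ : s * s ≈ ⟦ C.θ ⟧ * embed b) (w²≈ : w * w ≈ ⟦ C.θ+1 ⟧ * embed b * s) where
      open WithTorsionPoint s w s²≈ w²≈ using (unit-w; on; five-torsion)

      torsionField⊆ : ∀ {p} {S : Pred Carrier p} →
                      Adjoin E S ζ → Adjoin E S i → Adjoin E S w →
                      TorsionField E b 5 ⊆ Adjoin E S
      torsionField⊆ {S = S} ζ∈ i∈ w∈ = adjoin-least coordinate∈
        where
        ℤ[i]∈ : ∀ x → Adjoin E S (value morphism i x)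
        ℤ[i]∈ = value∈ morphism adjoin-integer i∈
        ℤ[i,η]∈ : ∀ x → Adjoin E S (value ℤ[i]⟶ η x)
        ℤ[i,η]∈ = value∈ ℤ[i]⟶ ℤ[i]∈ (add ζ∈ (adjoin-^ 4 ζ∈))
        ⟦⟧∈ : ∀ x → Adjoin E S ⟦ x ⟧
        ⟦⟧∈ = value∈ ℤ[i,η]⟶ ℤ[i,η]∈ ζ∈
        s∈ : Adjoin E S s
        -- s = w²/((θ + 1)b), so the inner square root comes with w.
        s∈ = adjoin-divide (unit-* unit-θ+1 unit-b) (sym w²≈)
               (mul (⟦⟧∈ C.θ+1) (base b)) (mul w∈ w∈)
        divide : ∀ h {x y} → Unit ⟦ h ⟧ → Adjoin E S y → ⟦ h ⟧ * x ≈ y → Adjoin E S x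
        divide h unit-h y∈ eq = adjoin-divide unit-h eq (⟦⟧∈ h) y∈
        divide± : ∀ h {x y} → Unit ⟦ h ⟧ → Adjoin E S y →
                  ⟦ h ⟧ * x ≈ y ⊎ ⟦ h ⟧ * x ≈ - y → Adjoin E S x
        divide± h unit-h y∈ = [ divide h unit-h y∈ , divide h unit-h (neg y∈) ]
        coordinates∈ : ∀ {x y z} → CoordinatesFrom s w x y → z ≈ x ⊎ z ≈ y → Adjoin E S z
        coordinates∈ (h , _ , unit-h , _ , hx≈ , _) (inj₁ z≈x) =
          resp (sym z≈x) (divide± h unit-h s∈ hx≈)
        coordinates∈ (_ , k , _ , unit-k , _ , ky≈) (inj₂ z≈y) =
          resp (sym z≈y) ([ divide± k unit-k w∈ , divide± k unit-k (mul i∈ w∈) ] ky≈)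
        coordinate∈ : TorsionCoordinate 5 ⊆ Adjoin E S
        coordinate∈ (x , y , on , 5P≈𝒪 , z≈) =
          coordinates∈ (torsion-coordinates s²≈ w²≈ on 5P≈𝒪) z≈

      private
        T : Pred Carrier _
        T = TorsionField E b 5

      w∈T : T w
      w∈T = gen (s , w , on , five-torsion , inj₂ refl)

      i∈T : T i
      i∈T = adjoin-divide unit-w (*-comm w i) w∈T
              (gen (- s , i * w , on′ , five-torsion′ , inj₂ refl))
        where
        open IntegerCoefficientSolver K̄ using (solve; _:=_; _:+_; _:*_; _:-_; :-_; _:^_; con)
        open QuadraticLift K̄ using (modulo)
        -- The automorphism (x , y) ↦ (- x , iy) of the curve.
        s′²≈ : - s * - s ≈ ⟦ C.θ ⟧ * embed b
        s′²≈ = trans (solve 1 (λ s → (:- s) :* (:- s) := s :* s) refl s) s²≈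
        w′²≈ : i * w * (i * w) ≈ ⟦ C.θ+1 ⟧ * embed b * - s
        w′²≈ = modulo w²≈ (modulo i²+1≈0 (solve 4 (λ s w i r →
          i :* w :* (i :* w)
          := r :* (:- s) :+ (:- con (+ 1)) :* (w :* w :- r :* s)
             :+ w :* w :* (i :^ 2 :+ con (+ 1) :- con (+ 0)))
          refl s w i (⟦ C.θ+1 ⟧ * embed b)))
        open WithTorsionPoint (- s) (i * w) s′²≈ w′²≈
          using () renaming (on to on′; five-torsion to five-torsion′)

      ζ∈T : T ζ
      ζ∈T = resp ⟦ζ⟧≈ζ (adjoin-divide
        -- `natural-unit n` inverts n + 1, so 63 gives the inverse of 64.
        (unit-resp (sym (⟦natural⟧ 64)) (natural-unit 63)) 64ζ (gaussian∈ (+ 64 , + 0))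
        (add (add (add (gaussian∈ C.a₀) (mul (gaussian∈ C.a₁) θ∈))
          (mul (gaussian∈ C.a₂) (mul θ∈ θ∈)))
          (mul (gaussian∈ C.a₃) (mul θ∈ (mul θ∈ θ∈)))))
        where
        s∈ : T s
        s∈ = gen (s , w , on , five-torsion , inj₁ refl)
        θ∈ : T ⟦ C.θ ⟧
        θ∈ = adjoin-divide unit-b (trans (*-comm (embed b) ⟦ C.θ ⟧) (sym s²≈)) (base b) (mul s∈ s∈)
        gaussian∈ : ∀ x → T ⟦ C.gaussian x ⟧
        gaussian∈ x = resp (sym (⟦gaussian⟧ x)) (value∈ morphism adjoin-integer i∈T x)

theorem2p2 : ∀ {c₁ ℓ₁ ℓ₁′ c₂ ℓ₂ ℓ₂′} (K : Field c₁ ℓ₁ ℓ₁′) (K̄ : Field c₂ ℓ₂ ℓ₂′) (E : Extension K K̄) →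
    IsNumberField K → IsAlgebraicClosure E →
    let module K = Field K
        open Field K̄
        open Extension E
    in
    (b : K.Carrier) → b K.≉ K.0# →
    (i ζ₅ : Carrier) → i ^ 2 + 1# ≈ 0# → IsPrimitiveRoot 5 ζ₅ →
    (√θ₁b √⟨θ₁+1⟩b√θ₁b : Carrier) →
    √θ₁b ^ 2 ≈ θ₁ K̄ i ζ₅ * embed b →
    √⟨θ₁+1⟩b√θ₁b ^ 2 ≈ (θ₁ K̄ i ζ₅ + 1#) * embed b * √θ₁b →
    TorsionField E b 5 ≐ Adjoin E ((_≈ ζ₅) ∪ (_≈ i) ∪ (_≈ √⟨θ₁+1⟩b√θ₁b))
theorem2p2 K K̄ E (ℚ⟶K , _) _ b b≉0 i ζ i²+1≈0 isPrimitive s w s²≈ w²≈ =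
    torsionField⊆ s*s≈ w*w≈ (gen (inj₁ refl)) (gen (inj₂ (inj₁ refl))) (gen (inj₂ (inj₂ refl)))
  , adjoin-least λ where
      (inj₁ z≈ζ)        → resp (sym z≈ζ) (ζ∈T s*s≈ w*w≈)
      (inj₂ (inj₁ z≈i)) → resp (sym z≈i) (i∈T s*s≈ w*w≈)
      (inj₂ (inj₂ z≈w)) → resp (sym z≈w) (w∈T s*s≈ w*w≈)
  where
  open Field K̄
  open Extension E
  open Units K̄ using (Unit)

  unit-b : Unit (embed b)
  unit-b = embed-unit E (Units.≉0⇒unit K b≉0)

  natural-unit : ∀ n → Unit (suc n · 1#)
  natural-unit n = embed-natural-unit E (suc n)
    (embed-natural-unit ℚ⟶K (suc n) (ℚ-natural-unit n))

  i²+1≈0′ : i ^ 2 + 1 · 1# ≈ 0#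
  -- The solver over ℤ reads the constant 1 as `1 · 1#`, which computes to `1# + 0#`.
  i²+1≈0′ = trans (+-congˡ (+-identityʳ 1#)) i²+1≈0

  open Coordinates.WithRoots K̄ (embed b) i ζ unit-b natural-unit i²+1≈0′ (Φ₅-root K̄ isPrimitive)
    using (⟦_⟧; θ₁≈⟦θ⟧; θ₁+1≈⟦θ+1⟧)
  open Generators.Relations E b i ζ s w unit-b natural-unit i²+1≈0′ (Φ₅-root K̄ isPrimitive)

  square : ∀ x → x * x ≈ x ^ 2
  square x = *-congˡ (sym (*-identityʳ x))

  s*s≈ : s * s ≈ ⟦ Cyclotomic.θ ⟧ * embed b
  s*s≈ = trans (square s) (trans s²≈ (*-congʳ θ₁≈⟦θ⟧))

  w*w≈ : w * w ≈ ⟦ Cyclotomic.θ+1 ⟧ * embed b * s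
  w*w≈ = trans (square w) (trans w²≈ (*-congʳ (*-congʳ θ₁+1≈⟦θ+1⟧)))
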